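{- Let $n\ge 1$ and let $\mathcal{S}_n$ be the Shi arrangement in $\mathbb{R}^n$, consisting of the hyperplanes $x_i - x_j = 0$ and $x_i - x_j = 1$ for all $1 \leq i < j \leq n$. The map $\sigma_n$ (defined below) is a bijection between the set of regions of $\mathcal{S}_n$ and the set of parking functions on $[n]$.
   Context: A region of an arrangement is a connected component of the complement of the union of its hyperplanes. A parking function on $[n]=\{1,\ldots,n\}$ is a map $f:[n]\to[n]$ such that for every $1\le j\le n$ the set $f^{ -1}(\{1,\ldots,j\})$ has at least $j$ elements. The diagram of a region $R$ of $\mathcal{S}_n$ is defined as follows. Let $w=w_1w_2\cdots w_n$ be the unique permutation of $[n]$ such that $x_{w_1}>x_{w_2}>\cdots>x_{w_n}$ holds on $R$; the position of $m\in[n]$ is the index $p$ with $w_p=m$. For each pair $i<j$ such that $x_i-x_j>1$ holds on $R$, draw an arc from $i$ to $j$ (it goes rightwards in $w$). Then remove every arc that contains another arc: an arc $(i,l)$ is removed if there is a different arc $(j,k)$ with $i$ weakly to the left of $j$ and $k$ weakly to the left of $l$ in $w$. The remaining arcs partition $[n]$ into chains (the connected components under the remaining arcs), each consisting of increasing integers. The map $\sigma_n$ sends $R$ to the function $f:[n]\to[n]$ where $f(i)$ is the position in $w$ of the leftmost element of the chain containing $i$. -}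

module Defs where

open import Level using (Level; 0ℓ; _⊔_) renaming (suc to lsuc)
open import Data.Nat.Base as ℕ using (ℕ; suc)
import Data.Nat.Solver as ℕ-Solver
open import Data.Integer.Base using (+_)
open import Data.Rational.Base as ℚ using (ℚ; 0ℚ; 1ℚ)
import Data.Rational.Properties as ℚₚ
import Data.Rational.Solver as ℚ-Solver
import Data.Rational.Unnormalised.Base as ℚᵘ
import Data.Rational.Unnormalised.Properties as ℚᵘₚ
open import Data.Fin.Base as Fin using (Fin; toℕ)
import Data.Fin.Properties as Finₚ
open import Data.Fin.Permutation using (Permutation′; _⟨$⟩ʳ_; _⟨$⟩ˡ_)
open import Data.List.Base using (length; filter; allFin)
open import Data.Product using (Σ; ∃; ∃-syntax; _×_; _,_; proj₁)
open import Data.Sum.Base using (_⊎_)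
open import Data.Vec.Functional using (Vector)
open import Relation.Binary.Bundles using (Setoid)
open import Relation.Binary.Core using (Rel)
import Relation.Binary.Construct.On as On
open import Relation.Binary.Construct.Closure.Equivalence using (EqClosure)
open import Relation.Binary.PropositionalEquality
  using (_≡_; _≢_; refl; cong; cong₂; _→-setoid_)
open import Relation.Nullary.Negation.Core using (¬_)
open import Relation.Unary using (Pred; _∈_; _⊆_; _∪_; _∩_; _≬_; _≐_)
open import Relation.Unary.Relation.Binary.Equality using (≐-setoid)

private
  variable
    ℓ : Level
    n : ℕ

------------------------------------------------------------------------
-- Real numbers, as Bishop's regular sequences of rationals

δ : ℕ → ℚ
δ k = + 1 ℚ./ suc k

record ℝ : Set where
  constructor mkℝ
  field
    seq     : ℕ → ℚ
    regular : ∀ j k → ℚ.∣ seq j ℚ.- seq k ∣ ℚ.≤ δ j ℚ.+ δ k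

open ℝ public

fromℚ : ℚ → ℝ
fromℚ q .seq     _   = q
fromℚ q .regular j k = begin
  ℚ.∣ q ℚ.- q ∣  ≡⟨ cong ℚ.∣_∣ (ℚₚ.+-inverseʳ q) ⟩
  0ℚ             ≤⟨ ℚₚ.nonNegative⁻¹ (δ j ℚ.+ δ k)
                      {{ℚₚ.nonNeg+nonNeg⇒nonNeg (δ j) {{ℚₚ.normalize-nonNeg 1 (suc j)}}
                                                (δ k) {{ℚₚ.normalize-nonNeg 1 (suc k)}}}} ⟩
  δ j ℚ.+ δ k    ∎
  where open ℚₚ.≤-Reasoning

0ℝ 1ℝ : ℝ
0ℝ = fromℚ 0ℚ
1ℝ = fromℚ 1ℚ

double : ℕ → ℕ
double k = k ℕ.+ suc k

δ-double : ∀ k → δ (double k) ℚ.+ δ (double k) ≡ δ k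
δ-double k = ℚₚ.toℚᵘ-injective (begin-equality
  ℚ.toℚᵘ (δ (double k) ℚ.+ δ (double k))              ≃⟨ ℚₚ.toℚᵘ-homo-+ (δ (double k)) (δ (double k)) ⟩
  ℚ.toℚᵘ (δ (double k)) ℚᵘ.+ ℚ.toℚᵘ (δ (double k))    ≃⟨ ℚᵘₚ.+-cong (toℚᵘ-δ (double k)) (toℚᵘ-δ (double k)) ⟩
  δᵘ (double k) ℚᵘ.+ δᵘ (double k)                    ≃⟨ ℚᵘ.*≡* (cong +_ (arith k)) ⟩
  δᵘ k                                                ≃⟨ toℚᵘ-δ k ⟨
  ℚ.toℚᵘ (δ k)                                        ∎)
  where
  open ℚᵘₚ.≤-Reasoning
  open ℕ-Solver.+-*-Solver
  δᵘ : ℕ → ℚᵘ.ℚᵘ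
  δᵘ j = ℚᵘ.mkℚᵘ (+ 1) j
  toℚᵘ-δ : ∀ j → ℚ.toℚᵘ (δ j) ℚᵘ.≃ δᵘ j
  toℚᵘ-δ j = ℚₚ.toℚᵘ-fromℚᵘ (δᵘ j)
  arith : ∀ k → (1 ℕ.* suc (double k) ℕ.+ 1 ℕ.* suc (double k)) ℕ.* suc k
              ≡ 1 ℕ.* (suc (double k) ℕ.* suc (double k))
  arith = solve 1 (λ k → let d = con 1 :+ (k :+ (con 1 :+ k)) in
    (con 1 :* d :+ con 1 :* d) :* (con 1 :+ k) := con 1 :* (d :* d)) refl

infixl 6 _-_

_-_ : ℝ → ℝ → ℝ
(x - y) .seq     k   = seq x (double k) ℚ.- seq y (double k)
(x - y) .regular j k = begin
  ℚ.∣ (a ℚ.- b) ℚ.- (c ℚ.- d) ∣            ≡⟨ cong ℚ.∣_∣ (rearrange a b c d) ⟩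
  ℚ.∣ (a ℚ.- c) ℚ.- (b ℚ.- d) ∣            ≤⟨ ℚₚ.∣p-q∣≤∣p∣+∣q∣ (a ℚ.- c) (b ℚ.- d) ⟩
  ℚ.∣ a ℚ.- c ∣ ℚ.+ ℚ.∣ b ℚ.- d ∣          ≤⟨ ℚₚ.+-mono-≤ (regular x (double j) (double k))
                                                         (regular y (double j) (double k)) ⟩
  (e ℚ.+ e′) ℚ.+ (e ℚ.+ e′)                ≡⟨ interchange e e′ ⟩
  (e ℚ.+ e) ℚ.+ (e′ ℚ.+ e′)                ≡⟨ cong₂ ℚ._+_ (δ-double j) (δ-double k) ⟩
  δ j ℚ.+ δ k                              ∎
  where
  open ℚₚ.≤-Reasoning
  open ℚ-Solver.+-*-Solver
  a b c d e e′ : ℚ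
  a  = seq x (double j)
  b  = seq y (double j)
  c  = seq x (double k)
  d  = seq y (double k)
  e  = δ (double j)
  e′ = δ (double k)
  rearrange : ∀ a b c d → (a ℚ.- b) ℚ.- (c ℚ.- d) ≡ (a ℚ.- c) ℚ.- (b ℚ.- d)
  rearrange = solve 4 (λ a b c d → (a :- b) :- (c :- d) := (a :- c) :- (b :- d)) refl
  interchange : ∀ e e′ → (e ℚ.+ e′) ℚ.+ (e ℚ.+ e′) ≡ (e ℚ.+ e) ℚ.+ (e′ ℚ.+ e′)
  interchange = solve 2 (λ e e′ → (e :+ e′) :+ (e :+ e′) := (e :+ e) :+ (e′ :+ e′)) refl

infix 4 _<_ _>_ _#_

-- A real x lies in the interval [seq x k - δ k , seq x k + δ k] for every k,
-- so x < y exactly when, at some stage, the interval of x is strictly to the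
-- left of the interval of y.
_<_ : Rel ℝ 0ℓ
x < y = ∃[ k ] seq x k ℚ.+ δ k ℚ.< seq y k ℚ.- δ k

_>_ : Rel ℝ 0ℓ
x > y = y < x

-- Apartness, the constructive form of x ≠ y.
_#_ : Rel ℝ 0ℓ
x # y = x < y ⊎ y < x

------------------------------------------------------------------------
-- Topology of ℝⁿ

ℝ^ : ℕ → Set
ℝ^ n = Vector ℝ n

-- Open balls of the maximum norm, which generate the usual topology.
Ball : ℝ^ n → ℝ → Pred (ℝ^ n) 0ℓ
Ball x ε y = ∀ i → x i - y i < ε × y i - x i < ε

IsOpen : Pred (ℝ^ n) 0ℓ → Set
IsOpen U = ∀ {x} → x ∈ U → ∃[ ε ] ε > 0ℝ × Ball x ε ⊆ U

-- Positive form of "S is not the disjoint union of two nonempty relatively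
-- open subsets": open sets that cover S and both meet S overlap within S.
IsConnected : Pred (ℝ^ n) ℓ → Set (lsuc 0ℓ ⊔ ℓ)
IsConnected S = ∀ U V → IsOpen U → IsOpen V →
                S ⊆ U ∪ V → S ≬ U → S ≬ V → S ≬ (U ∩ V)

-- The component of x in A is the union of the connected subsets of A
-- containing x.
Component : Pred (ℝ^ n) 0ℓ → ℝ^ n → Pred (ℝ^ n) (lsuc 0ℓ)
Component {n} A x y =
  Σ (Pred (ℝ^ n) 0ℓ) λ S → S ⊆ A × IsConnected S × x ∈ S × y ∈ S

------------------------------------------------------------------------
-- Regions of the Shi arrangement.  Throughout, Fin n stands for
-- [n] = {1, …, n}, with i : Fin n representing the number 1 + toℕ i.

ShiComplement : ∀ n → Pred (ℝ^ n) 0ℓ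
ShiComplement n x =
  ∀ {i j : Fin n} → i Fin.< j → x i - x j # 0ℝ × x i - x j # 1ℝ

record Region (n : ℕ) : Set (lsuc (lsuc 0ℓ)) where
  field
    points      : Pred (ℝ^ n) (lsuc 0ℓ)
    isComponent : ∃[ x ] x ∈ ShiComplement n × points ≐ Component (ShiComplement n) x

open Region public

regions : ℕ → Setoid (lsuc (lsuc 0ℓ)) (lsuc 0ℓ)
regions n = On.setoid (≐-setoid (ℝ^ n) (lsuc 0ℓ)) (points {n})

------------------------------------------------------------------------
-- Parking functions

-- The bound "at least 1 + toℕ j elements" is written with a strict
-- inequality.
IsParking : Pred (Fin n → Fin n) 0ℓ
IsParking {n} f =
  ∀ (j : Fin n) → toℕ j ℕ.< length (filter (λ i → f i Finₚ.≤? j) (allFin n))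

ParkingFunction : ℕ → Set
ParkingFunction n = Σ (Fin n → Fin n) IsParking

parkingFunctions : ℕ → Setoid 0ℓ 0ℓ
parkingFunctions n = On.setoid (Fin n →-setoid Fin n) (proj₁ {B = IsParking {n}})

------------------------------------------------------------------------
-- The diagram of a region and the map σ

-- The word w₁ ⋯ wₙ is encoded as the permutation p ↦ w_p, so that w ⟨$⟩ˡ m
-- is the position of m.
OrderedBy : Region n → Permutation′ n → Set (lsuc 0ℓ)
OrderedBy {n} R w =
  ∀ x → x ∈ points R → ∀ {p q : Fin n} → p Fin.< q → x (w ⟨$⟩ʳ p) > x (w ⟨$⟩ʳ q)

InitialArc : Region n → Rel (Fin n) (lsuc 0ℓ)
InitialArc R i j = i Fin.< j × (∀ x → x ∈ points R → x i - x j > 1ℝ)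

module Diagram (R : Region n) (w : Permutation′ n) where

  position : Fin n → Fin n
  position m = w ⟨$⟩ˡ m

  ContainsAnother : Rel (Fin n) (lsuc 0ℓ)
  ContainsAnother i l =
    ∃[ j ] ∃[ k ] InitialArc R j k × (j , k) ≢ (i , l) ×
                  position i Fin.≤ position j × position k Fin.≤ position l

  Arc : Rel (Fin n) (lsuc 0ℓ)
  Arc i l = InitialArc R i l × ¬ ContainsAnother i l

  SameChain : Rel (Fin n) (lsuc 0ℓ)
  SameChain = EqClosure Arc

  IsLeftmostInChainOf : Rel (Fin n) (lsuc 0ℓ)
  IsLeftmostInChainOf m i =
    SameChain i m × (∀ k → SameChain i k → position m Fin.≤ position k)

-- The graph of σ.
Sends : Region n → (Fin n → Fin n) → Set (lsuc 0ℓ)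
Sends R f = ∃[ w ] OrderedBy R w ×
  (∀ i → ∃[ m ] Diagram.IsLeftmostInChainOf R w m i × f i ≡ Diagram.position R w m)

{-# OPTIONS --safe #-}

-- Two points of the complement lie in one component exactly when they lie on
-- the same side of every hyperplane: a hyperplane between them would split a
-- connected set, and conversely a finite intersection of open half-spaces is
-- connected, because along a segment one can bisect towards a common point of
-- two open sets that cover it.  So a region amounts to the word w together with
-- the set of pairs i < j with xᵢ - xⱼ > 1, and these are the pairs that contain
-- one of the remaining arcs.
--
-- The remaining arcs do not nest, so the chains are served first in, first out.
-- Reading w from left to right, the letter at position p is the least element
-- of f⁻¹(p) if that fibre is nonempty, and otherwise the successor, within its
-- fibre, of the earliest letter whose successor has not occurred yet.  Hence f
-- determines w and the arcs.  The parking condition says that such a letter is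
-- always available, so every parking function yields a word with nonnesting
-- arcs; and every nonnesting set of arcs is realised by a point, whose
-- coordinates are chosen greedily from left to right (it is a semiorder).
module Submission where

open import Defs renaming (_<_ to _<ᵣ_; _>_ to _>ᵣ_; _-_ to _-ᵣ_)
open import Level using (Level; 0ℓ)
open import Data.Nat.Base as ℕ using (ℕ; zero; suc; _≤_; s≤s; z≤n)
import Data.Nat.Properties as ℕₚ
open import Data.Nat.Induction using (<-wellFounded)
import Data.Integer.Base as ℤ
import Data.Integer.Properties as ℤₚ
open import Data.Rational.Base as ℚ using (ℚ; 0ℚ; 1ℚ; ½; mkℚ)
import Data.Rational.Properties as ℚₚ
open import Data.Rational.Solver using (module +-*-Solver)
import Data.Rational.Unnormalised.Base as ℚᵘ
import Data.Rational.Unnormalised.Properties as ℚᵘₚ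
open import Data.Fin.Base as Fin using (Fin; toℕ; fromℕ<)
open import Data.Fin.Properties as Finₚ using (any?; all?; toℕ-injective; toℕ<n)
open import Data.Fin.Permutation as Perm using (Permutation′; _⟨$⟩ʳ_; _⟨$⟩ˡ_)
open import Data.List.Base using (List; _∷_; length; filter; allFin; lookup)
open import Data.List.Membership.Propositional using () renaming (_∈_ to _∈ₗ_)
open import Data.List.Membership.Propositional.Properties using (∈-filter⁺; ∈-filter⁻; ∈-allFin; ∈-lookup)
import Data.List.Relation.Unary.All as All
open import Data.List.Relation.Unary.AllPairs using (_∷_)
open import Data.List.Relation.Unary.Any using (index)
open import Data.List.Relation.Unary.Any.Properties using (lookup-index)
open import Data.List.Relation.Unary.Unique.Propositional using (Unique)
open import Data.List.Relation.Unary.Unique.Propositional.Properties using (allFin⁺; filter⁺)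
open import Data.Product using (Σ-syntax; ∃; ∃-syntax; _×_; _,_; proj₁; proj₂)
open import Data.Product.Properties using (≡-dec)
open import Data.Sum.Base as Sum using (_⊎_; inj₁; inj₂)
open import Function.Base using (_∘_; flip; id)
open import Function.Bundles using (Bijection; _⇔_; mk⇔)
open import Function.Definitions using (Injective)
open import Induction.WellFounded using (Acc; acc)
open import Relation.Binary.Core using (Rel)
open import Relation.Binary.Definitions using (Decidable; Tri; tri<; tri≈; tri>)
open import Relation.Binary.PropositionalEquality
import Relation.Binary.Construct.Closure.Equivalence as EqC
open import Relation.Binary.Construct.Closure.Equivalence using (EqClosure)
open import Relation.Binary.Construct.Closure.ReflexiveTransitive using (Star; _◅_; reverse) renaming (ε to nil)
open import Relation.Binary.Construct.Closure.Symmetric using (fwd; bwd)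
open import Relation.Nullary.Decidable using (Dec; yes; no; _×-dec_; _→-dec_; ¬?)
open import Relation.Nullary.Negation.Core using (¬_; contradiction)
open import Relation.Unary as U using (Pred; _∈_; _⊆_; _≐_)

-- Constructively, a sign cannot be decided at an arbitrary real, but a point of the complement is
-- apart from every hyperplane and so tells on which side it lies. A region comes with one such
-- point, its centre; decisions about the region are taken there and carried to its other points by
-- connectedness. The sets in `IsConnected` are predicates on regular sequences and are not assumed
-- to respect equality of reals, so openness has to move membership between two sequences for the
-- same real. Bijectivity is reduced to `Layout`, which speaks of `f` and the word alone. This is
-- possible because values increase along a chain from left to right: a fibre of `f`, sorted by
-- value, is a chain, and the arcs are its consecutive pairs.

private
  variable
    ℓ ℓ′ : Level
    n : ℕ

-- Strict inequalities between regular sequences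

module ℚ-Arithmetic where

  open import Data.Integer.Base using (+_; -[1+_])
  open import Data.Rational.Base using (_+_; _*_; _-_; -_; _/_; ∣_∣; toℚᵘ; *<*; *≤*)
  open +-*-Solver using (solve; _:=_; _:+_; _:*_; _:-_; :-_; con)

  -- Linear arithmetic: an inequality follows from one with the same difference of sides.
  shift-≤ : ∀ {p q p′ q′} → p ℚ.≤ q → p′ + q ≡ q′ + p → p′ ℚ.≤ q′
  shift-≤ {p} {q} {p′} {q′} p≤q eq = begin
    p′            ≡⟨ solve 2 (λ x y → x := (x :+ y) :- y) refl p′ q ⟩
    (p′ + q) - q  ≡⟨ cong (_- q) eq ⟩
    (q′ + p) - q  ≤⟨ ℚₚ.+-monoˡ-≤ (- q) (ℚₚ.+-monoʳ-≤ q′ p≤q) ⟩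
    (q′ + q) - q  ≡⟨ solve 2 (λ x y → x := (x :+ y) :- y) refl q′ q ⟨
    q′            ∎
    where open ℚₚ.≤-Reasoning

  shift-< : ∀ {p q p′ q′} → p ℚ.< q → p′ + q ≡ q′ + p → p′ ℚ.< q′
  shift-< {p} {q} {p′} {q′} p<q eq = begin-strict
    p′            ≡⟨ solve 2 (λ x y → x := (x :+ y) :- y) refl p′ q ⟩
    (p′ + q) - q  ≡⟨ cong (_- q) eq ⟩
    (q′ + p) - q  <⟨ ℚₚ.+-monoˡ-< (- q) (ℚₚ.+-monoʳ-< q′ p<q) ⟩
    (q′ + q) - q  ≡⟨ solve 2 (λ x y → x := (x :+ y) :- y) refl q′ q ⟨
    q′            ∎
    where open ℚₚ.≤-Reasoning

  p≤∣p∣ : ∀ p → p ℚ.≤ ∣ p ∣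
  p≤∣p∣ p with ℚₚ.≤-total 0ℚ p
  ... | inj₁ 0≤p = ℚₚ.≤-reflexive (sym (ℚₚ.0≤p⇒∣p∣≡p 0≤p))
  ... | inj₂ p≤0 = ℚₚ.≤-trans p≤0 (ℚₚ.0≤∣p∣ p)

  ∣-∣-elim : ∀ {p q r} → ∣ p - q ∣ ℚ.≤ r → p ℚ.≤ q + r
  ∣-∣-elim {p} {q} {r} h = shift-≤ (ℚₚ.≤-trans (p≤∣p∣ (p - q)) h)
    (solve 3 (λ p q r → p :+ r := (q :+ r) :+ (p :- q)) refl p q r)

  ∣-∣-intro : ∀ {p q r} → p ℚ.≤ q + r → q ℚ.≤ p + r → ∣ p - q ∣ ℚ.≤ r
  ∣-∣-intro {p} {q} {r} h h′ with ℚₚ.∣p∣≡p∨∣p∣≡-p (p - q)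
  ... | inj₁ eq = subst (ℚ._≤ r) (sym eq) (shift-≤ h
    (solve 3 (λ p q r → (p :- q) :+ (q :+ r) := r :+ p) refl p q r))
  ... | inj₂ eq = subst (ℚ._≤ r) (sym eq) (shift-≤ h′
    (solve 3 (λ p q r → (:- (p :- q)) :+ (p :+ r) := r :+ q) refl p q r))

  ∣-∣-sym : ∀ p q → ∣ p - q ∣ ≡ ∣ q - p ∣
  ∣-∣-sym p q = trans (sym (ℚₚ.∣-p∣≡∣p∣ (p - q)))
    (cong ∣_∣ (solve 2 (λ p q → :- (p :- q) := q :- p) refl p q))

  toℚᵘ-δ : ∀ k → toℚᵘ (δ k) ℚᵘ.≃ ℚᵘ.mkℚᵘ (+ 1) k
  toℚᵘ-δ k = ℚₚ.toℚᵘ-fromℚᵘ (ℚᵘ.mkℚᵘ (+ 1) k)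

  δ-pos : ∀ k → 0ℚ ℚ.< δ k
  δ-pos k = ℚₚ.positive⁻¹ (δ k) {{ℚₚ.normalize-pos 1 (suc k)}}

  δ-antimono : ∀ {j k} → j ≤ k → δ k ℚ.≤ δ j
  δ-antimono {j} {k} j≤k = ℚₚ.toℚᵘ-cancel-≤ (begin
    toℚᵘ (δ k)         ≃⟨ toℚᵘ-δ k ⟩
    ℚᵘ.mkℚᵘ (+ 1) k    ≤⟨ ℚᵘ.*≤* (ℤ.+≤+ (ℕₚ.+-monoˡ-≤ 0 (ℕ.s≤s j≤k))) ⟩
    ℚᵘ.mkℚᵘ (+ 1) j    ≃⟨ toℚᵘ-δ j ⟨
    toℚᵘ (δ j)         ∎)
    where open ℚᵘₚ.≤-Reasoning

  -- A positive fraction is at least one over its denominator. Both `mkℚ` and `δ` are indexed by the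
  -- denominator minus one, so `d` itself is the witness.
  δ-archimedean : ∀ {ε} → 0ℚ ℚ.< ε → ∃[ k ] δ k ℚ.≤ ε
  δ-archimedean {mkℚ (+ zero) d c} (*<* (ℤ.+<+ ()))
  δ-archimedean {mkℚ -[1+ m ] d c} (*<* ())
  δ-archimedean {mkℚ (+ suc m) d c} _ = d , ℚₚ.toℚᵘ-cancel-≤ (begin
    toℚᵘ (δ d)              ≃⟨ toℚᵘ-δ d ⟩
    ℚᵘ.mkℚᵘ (+ 1) d         ≤⟨ ℚᵘ.*≤* (ℤ.+≤+ (ℕₚ.*-monoˡ-≤ (suc d) (ℕ.s≤s (ℕ.z≤n {m})))) ⟩
    ℚᵘ.mkℚᵘ (+ suc m) d     ∎)
    where open ℚᵘₚ.≤-Reasoning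

  ι : ℕ → ℚ
  ι m = + m / 1

  toℚᵘ-ι : ∀ m → toℚᵘ (ι m) ℚᵘ.≃ ℚᵘ.mkℚᵘ (+ m) 0
  toℚᵘ-ι m = ℚₚ.toℚᵘ-fromℚᵘ (ℚᵘ.mkℚᵘ (+ m) 0)

  ι-bound : ∀ r → ∃[ m ] r ℚ.≤ ι (suc m)
  ι-bound (mkℚ -[1+ m ] d c) = 0 , *≤* ℤ.-≤+
  ι-bound (mkℚ (+ m) d c) = m , ℚₚ.toℚᵘ-cancel-≤ (begin
    ℚᵘ.mkℚᵘ (+ m) d        ≤⟨ ℚᵘ.*≤* (subst₂ ℤ._≤_ (ℤₚ.pos-* m 1) (ℤₚ.pos-* (suc m) (suc d))
                                (ℤ.+≤+ (ℕₚ.*-mono-≤ (ℕₚ.n≤1+n m) (ℕ.s≤s (ℕ.z≤n {d}))))) ⟩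
    ℚᵘ.mkℚᵘ (+ suc m) 0    ≃⟨ toℚᵘ-ι (suc m) ⟨
    toℚᵘ (ι (suc m))       ∎)
    where open ℚᵘₚ.≤-Reasoning

  ι-mono : ∀ {l m} → l ≤ m → ι l ℚ.≤ ι m
  ι-mono {l} {m} l≤m = ℚₚ.toℚᵘ-cancel-≤ (begin
    toℚᵘ (ι l)         ≃⟨ toℚᵘ-ι l ⟩
    ℚᵘ.mkℚᵘ (+ l) 0    ≤⟨ ℚᵘ.*≤* (subst₂ ℤ._≤_ (ℤₚ.pos-* l 1) (ℤₚ.pos-* m 1)
                            (ℤ.+≤+ (ℕₚ.*-monoˡ-≤ 1 l≤m))) ⟩
    ℚᵘ.mkℚᵘ (+ m) 0    ≃⟨ toℚᵘ-ι m ⟨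
    toℚᵘ (ι m)         ∎)
    where open ℚᵘₚ.≤-Reasoning

  δ-scale : ∀ m k → ι (suc m) * δ (k ℕ.+ m ℕ.* suc k) ≡ δ k
  δ-scale m k = ℚₚ.toℚᵘ-injective (begin-equality
    toℚᵘ (ι (suc m) * δ l)                       ≃⟨ ℚₚ.toℚᵘ-homo-* (ι (suc m)) (δ l) ⟩
    toℚᵘ (ι (suc m)) ℚᵘ.* toℚᵘ (δ l)             ≃⟨ ℚᵘₚ.*-cong (toℚᵘ-ι (suc m)) (toℚᵘ-δ l) ⟩
    ℚᵘ.mkℚᵘ (+ suc m) 0 ℚᵘ.* ℚᵘ.mkℚᵘ (+ 1) l     ≃⟨ ℚᵘ.*≡* (cong +_ (arith m k)) ⟩
    ℚᵘ.mkℚᵘ (+ 1) k                              ≃⟨ toℚᵘ-δ k ⟨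
    toℚᵘ (δ k)                                   ∎)
    where
    open ℚᵘₚ.≤-Reasoning
    l = k ℕ.+ m ℕ.* suc k
    arith : ∀ m k → suc m ℕ.* 1 ℕ.* suc k ≡ 1 ℕ.* (1 ℕ.* suc (k ℕ.+ m ℕ.* suc k))
    arith m k = trans (cong (ℕ._* suc k) (ℕₚ.*-identityʳ (suc m))) (sym (trans (ℕₚ.*-identityˡ _) (ℕₚ.*-identityˡ _)))

  infixr 6 _⊕_
  _⊕_ : ∀ {p q r s} → p ℚ.≤ q → r ℚ.≤ s → p + r ℚ.≤ q + s
  _⊕_ = ℚₚ.+-mono-≤

  ½-pos : ∀ {ε} → 0ℚ ℚ.< ε → 0ℚ ℚ.< ½ * ε
  ½-pos 0<ε = ℚₚ.*-monoʳ-<-pos ½ 0<ε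

  δ-small : ∀ {ε} → 0ℚ ℚ.< ε → ∀ N → ∃[ k ] N ≤ k × δ k + δ k ℚ.< ε
  δ-small {ε} 0<ε N with k , δk≤ε ← δ-archimedean 0<ε =
    k′ , ℕₚ.m≤m+n N _ , (begin-strict
      δ k′ + δ k′                                    ≤⟨ δk′≤ ⊕ δk′≤ ⟩
      δ (double (double k)) + δ (double (double k))  ≡⟨ δ-double (double k) ⟩
      δ (double k)                                   ≡⟨ ℚₚ.+-identityʳ (δ (double k)) ⟨
      δ (double k) + 0ℚ                              <⟨ ℚₚ.+-monoʳ-< (δ (double k)) (δ-pos (double k)) ⟩
      δ (double k) + δ (double k)                    ≡⟨ δ-double k ⟩
      δ k                                            ≤⟨ δk≤ε ⟩
      ε                                              ∎)
    where
    open ℚₚ.≤-Reasoning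
    -- Doubling twice divides `δ k` by 4, so two copies make half of `δ k`, strictly less than
    -- `δ k`.
    k′ = N ℕ.+ double (double k)
    δk′≤ = δ-antimono (ℕₚ.m≤n+m (double (double k)) N)

module Gaps where

  open ℚ-Arithmetic
  open import Data.Rational.Base using (_+_; _*_; _-_; -_)
  open +-*-Solver using (solve; _:=_; _:+_; _:*_; _:-_; :-_; con)

  -- x - y > q, witnessed on the approximations of x and y at equal indices.
  record Gap (x y : ℝ) (q : ℚ) : Set where
    constructor gap
    field
      ε     : ℚ
      ε>0   : 0ℚ ℚ.< ε
      N     : ℕ
      bound : ∀ k → N ≤ k → q + ε ℚ.≤ seq x k - seq y k

  seq-≤ : ∀ x j k → seq x j ℚ.≤ seq x k + (δ j + δ k)
  seq-≤ x j k = ∣-∣-elim (regular x j k)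

  k≤double : ∀ k → k ≤ double k
  k≤double k = ℕₚ.m≤m+n k (suc k)

  pos-diff : ∀ {p q} → p ℚ.< q → 0ℚ ℚ.< q - p
  pos-diff {p} {q} h = shift-< h (solve 2 (λ p q → con 0ℚ :+ q := (q :- p) :+ p) refl p q)

  -- The witness at stage k compares approximations at K = `double k` and leaves a slack of `δ k` on
  -- each side. From K to any later m, each of x and y moves by at most `δ K + δ m`, hence by at
  -- most `δ k`, so the margin left over is the same for all m.
  >⇒Gap : ∀ {x y q} → x -ᵣ y >ᵣ fromℚ q → Gap x y q
  >⇒Gap {x} {y} {q} (k , h) = gap _ (pos-diff h) K λ m K≤m →
    shift-≤ (seq-≤ x K m ⊕ seq-≤ y m K ⊕ δ-antimono K≤m ⊕ δ-antimono K≤m ⊕ 2δ≤ ⊕ 2δ≤)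
      (solve 8 (λ q X Y D X′ Y′ E E′ →
        (q :+ ((X :- Y :- D) :- (q :+ D)))
          :+ ((X′ :+ (E :+ E′)) :+ ((Y :+ (E′ :+ E)) :+ (E :+ (E :+ (D :+ D)))))
        := (X′ :- Y′) :+ (X :+ (Y′ :+ (E′ :+ (E′ :+ ((E :+ E) :+ (E :+ E)))))))
        refl q (seq x K) (seq y K) (δ k) (seq x m) (seq y m) (δ K) (δ m))
    where
    K = double k
    2δ≤ = ℚₚ.≤-reflexive (δ-double k)

  Gap⇒> : ∀ {x y q} → Gap x y q → x -ᵣ y >ᵣ fromℚ q
  Gap⇒> {x} {y} {q} (gap ε 0<ε N h) =
    let k , N≤k , 2δ<ε = δ-small 0<ε N in
    k , shift-< (ℚₚ.+-mono-<-≤ 2δ<ε (h (double k) (ℕₚ.≤-trans N≤k (k≤double k))))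
      (solve 4 (λ q d e Z → (q :+ d) :+ (e :+ Z) := (Z :- d) :+ ((d :+ d) :+ (q :+ e)))
        refl q (δ k) ε (seq x (double k) - seq y (double k)))

  <⇒Gap : ∀ {x y q} → x -ᵣ y <ᵣ fromℚ q → Gap y x (- q)
  <⇒Gap {x} {y} {q} (k , h) = >⇒Gap {y} {x} { - q} (k , shift-< h
    (solve 4 (λ q d X Y → ((:- q) :+ d) :+ (q :- d) := (Y :- X :- d) :+ (X :- Y :+ d))
      refl q (δ k) (seq x (double k)) (seq y (double k))))

  Gap⇒< : ∀ {x y q} → Gap y x (- q) → x -ᵣ y <ᵣ fromℚ q
  Gap⇒< {x} {y} {q} g =
    let k , h = Gap⇒> g in
    k , shift-< h
    (solve 4 (λ q d X Y → (X :- Y :+ d) :+ (Y :- X :- d) := (q :- d) :+ ((:- q) :+ d))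
      refl q (δ k) (seq x (double k)) (seq y (double k)))

  Gap⇒>ᵣ : ∀ {x y} → Gap x y 0ℚ → x >ᵣ y
  Gap⇒>ᵣ {x} {y} (gap ε 0<ε N h) =
    let k , N≤k , 2δ<ε = δ-small 0<ε N in
    k , shift-< (ℚₚ.+-mono-<-≤ 2δ<ε (h k N≤k))
      (solve 4 (λ X Y d e → (Y :+ d) :+ (e :+ (X :- Y)) := (X :- d) :+ ((d :+ d) :+ (con 0ℚ :+ e)))
        refl (seq x k) (seq y k) (δ k) ε)

  >ᵣ⇒Gap : ∀ {x y} → x >ᵣ y → Gap x y 0ℚ
  >ᵣ⇒Gap {x} {y} (k , h) =
    let N , _ , 2δ<η = δ-small (pos-diff h) 0 in
    gap _ (pos-diff 2δ<η) N λ m N≤m →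
    shift-≤ (seq-≤ x k m ⊕ seq-≤ y m k ⊕ δ-antimono N≤m ⊕ δ-antimono N≤m)
      (solve 7 (λ X Y D X′ Y′ E F →
        (con 0ℚ :+ (((X :- D) :- (Y :+ D)) :- (F :+ F)))
          :+ ((X′ :+ (D :+ E)) :+ ((Y :+ (E :+ D)) :+ (F :+ F)))
        := (X′ :- Y′) :+ (X :+ (Y′ :+ (E :+ E))))
        refl (seq x k) (seq y k) (δ k) (seq x m) (seq y m) (δ m) (δ N))

  Gap-trans : ∀ {x y z p q} → Gap x y p → Gap y z q → Gap x z (p + q)
  Gap-trans {x} {y} {z} {p} {q} (gap ε 0<ε N h) (gap ε′ 0<ε′ N′ h′) =
    gap (ε + ε′) (ℚₚ.+-mono-< 0<ε 0<ε′) (N ℕ.⊔ N′) λ k N≤k →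
    shift-≤ (h k (ℕₚ.m⊔n≤o⇒m≤o N N′ N≤k) ⊕ h′ k (ℕₚ.m⊔n≤o⇒n≤o N N′ N≤k))
      (solve 7 (λ p q e e′ X Y Z →
        ((p :+ q) :+ (e :+ e′)) :+ ((X :- Y) :+ (Y :- Z)) := (X :- Z) :+ ((p :+ e) :+ (q :+ e′)))
        refl p q ε ε′ (seq x k) (seq y k) (seq z k))

  Gap-weaken : ∀ {x y p q} → p ℚ.≤ q → Gap x y q → Gap x y p
  Gap-weaken p≤q (gap ε 0<ε N h) = gap ε 0<ε N λ k N≤k →
    ℚₚ.≤-trans (ℚₚ.+-monoˡ-≤ ε p≤q) (h k N≤k)

  -- Half of the margin is added to the bound and the other half keeps the inequality strict. The
  -- added part is the room in which `Gap-open` fits a ball: each of the two coordinates may consume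
  -- half of it.
  Gap-widen : ∀ {x y q} → Gap x y q → ∃[ ε ] 0ℚ ℚ.< ε × Gap x y (q + ε)
  Gap-widen {q = q} (gap ε 0<ε N h) = ½ * ε , ½-pos 0<ε , gap (½ * ε) (½-pos 0<ε) N λ k N≤k →
    subst (ℚ._≤ _) (solve 2 (λ q e → q :+ e := (q :+ con ½ :* e) :+ con ½ :* e) refl q ε) (h k N≤k)

  Gap-irrefl : ∀ {x q} → Gap x x q → q ℚ.< 0ℚ
  Gap-irrefl {x} {q} (gap ε 0<ε N h) =
    shift-< (ℚₚ.+-mono-<-≤ 0<ε (h N ℕₚ.≤-refl))
      (solve 3 (λ q e X → q :+ (e :+ (X :- X)) := con 0ℚ :+ (con 0ℚ :+ (q :+ e))) refl q ε (seq x N))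

  Gap-asym : ∀ {x y p q} → 0ℚ ℚ.≤ p + q → Gap x y p → ¬ Gap y x q
  Gap-asym 0≤p+q g g′ = ℚₚ.<-irrefl refl (ℚₚ.<-≤-trans (Gap-irrefl (Gap-trans g g′)) 0≤p+q)

  Gap-fromℚ : ∀ {a b q} → q ℚ.< a - b → Gap (fromℚ a) (fromℚ b) q
  Gap-fromℚ {a} {b} {q} h = gap ((a - b) - q) (pos-diff h) 0 λ _ _ → ℚₚ.≤-reflexive
    (solve 2 (λ z q → q :+ (z :- q) := z) refl (a - b) q)

  Gap-open : ∀ {n} (i j : Fin n) q → IsOpen (λ z → Gap (z i) (z j) q)
  Gap-open i j q {x} g =
    let ε , 0<ε , g′ = Gap-widen g in
    fromℚ (½ * ε) , Gap⇒>ᵣ (Gap-fromℚ {½ * ε} {0ℚ} (subst (0ℚ ℚ.<_) (sym (ℚₚ.+-identityʳ _)) (½-pos 0<ε))) , λ {z} b →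
    subst (Gap (z i) (z j))
      (solve 2 (λ q e → (:- (con ½ :* e) :+ (q :+ e)) :- (con ½ :* e) := q) refl q ε)
      (Gap-trans (Gap-trans (<⇒Gap {x i} {z i} {½ * ε} (proj₁ (b i))) g′) (<⇒Gap {z j} {x j} {½ * ε} (proj₂ (b j))))

-- Connectedness of intersections of half-spaces

eventually-all : ∀ {n} {P : Fin n → ℕ → Set} →
                 (∀ i {l m} → l ≤ m → P i l → P i m) →
                 (∀ i → ∃[ m ] P i m) → ∃[ m ] (∀ i → P i m)
eventually-all {zero}  mono ex = 0 , λ ()
eventually-all {suc n} mono ex =
  let m , h = ex Fin.zero
      m′ , h′ = eventually-all (λ i → mono (Fin.suc i)) (λ i → ex (Fin.suc i))
  in m ℕ.⊔ m′ , λ where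
    Fin.zero    → mono Fin.zero (ℕₚ.m≤m⊔n m m′) h
    (Fin.suc i) → mono (Fin.suc i) (ℕₚ.m≤n⊔m m m′) (h′ i)

-- Convex combinations and the segment between two points

module Mixing where

  open ℚ-Arithmetic
  open import Data.Rational.Base using (_+_; _*_; _-_; ∣_∣)
  open +-*-Solver using (solve; _:=_; _:+_; _:*_; _:-_; con)

  mix : ℚ → ℚ → ℚ → ℚ
  mix t a b = (1ℚ - t) * a + t * b

  mix-mono : ∀ {t a b a′ b′} → 0ℚ ℚ.≤ t → t ℚ.≤ 1ℚ → a ℚ.≤ a′ → b ℚ.≤ b′ → mix t a b ℚ.≤ mix t a′ b′
  mix-mono {t} 0≤t t≤1 a≤a′ b≤b′ =
    ℚₚ.*-monoˡ-≤-nonNeg (1ℚ - t) {{ℚ.nonNegative 0≤1-t}} a≤a′ ⊕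
    ℚₚ.*-monoˡ-≤-nonNeg t {{ℚ.nonNegative 0≤t}} b≤b′
    where
    0≤1-t : 0ℚ ℚ.≤ 1ℚ - t
    0≤1-t = shift-≤ t≤1 (solve 1 (λ t → con 0ℚ :+ con 1ℚ := (con 1ℚ :- t) :+ t) refl t)

  mix-const : ∀ t p → mix t p p ≡ p
  mix-const = solve 2 (λ t p → (con 1ℚ :- t) :* p :+ t :* p := p) refl

  mix-+ : ∀ t a b e → mix t (a + e) (b + e) ≡ mix t a b + e
  mix-+ = solve 4 (λ t a b e → (con 1ℚ :- t) :* (a :+ e) :+ t :* (b :+ e)
                            := ((con 1ℚ :- t) :* a :+ t :* b) :+ e) refl

  mix-- : ∀ t a b a′ b′ → mix t (a - a′) (b - b′) ≡ mix t a b - mix t a′ b′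
  mix-- = solve 5 (λ t a b a′ b′ → (con 1ℚ :- t) :* (a :- a′) :+ t :* (b :- b′)
                  := ((con 1ℚ :- t) :* a :+ t :* b) :- ((con 1ℚ :- t) :* a′ :+ t :* b′)) refl

  mix-shift : ∀ s t a b → mix s a b ≡ mix t a b + (s - t) * (b - a)
  mix-shift = solve 4 (λ s t a b → (con 1ℚ :- s) :* a :+ s :* b
                  := ((con 1ℚ :- t) :* a :+ t :* b) :+ (s :- t) :* (b :- a)) refl

  mix-0 : ∀ a b → mix 0ℚ a b ≡ a
  mix-0 = solve 2 (λ a b → (con 1ℚ :- con 0ℚ) :* a :+ con 0ℚ :* b := a) refl

  mix-1 : ∀ a b → mix 1ℚ a b ≡ b
  mix-1 = solve 2 (λ a b → (con 1ℚ :- con 1ℚ) :* a :+ con 1ℚ :* b := b) refl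

  mix-Lipschitz : ∀ s t {e} a b → ∣ s - t ∣ ℚ.≤ e → mix s a b ℚ.≤ mix t a b + e * ∣ b - a ∣
  mix-Lipschitz s t {e} a b ∣s-t∣≤e = begin
    mix s a b                              ≡⟨ mix-shift s t a b ⟩
    mix t a b + (s - t) * (b - a)          ≤⟨ ℚₚ.+-monoʳ-≤ (mix t a b) (p≤∣p∣ _) ⟩
    mix t a b + ∣ (s - t) * (b - a) ∣      ≡⟨ cong (mix t a b +_) (ℚₚ.∣p*q∣≡∣p∣*∣q∣ (s - t) (b - a)) ⟩
    mix t a b + ∣ s - t ∣ * ∣ b - a ∣      ≤⟨ ℚₚ.+-monoʳ-≤ (mix t a b)
                                               (ℚₚ.*-monoʳ-≤-nonNeg ∣ b - a ∣ {{ℚₚ.∣-∣-nonNeg (b - a)}} ∣s-t∣≤e) ⟩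
    mix t a b + e * ∣ b - a ∣              ∎
    where open ℚₚ.≤-Reasoning

  midpoint : ∀ p q → p ℚ.≤ q → p ℚ.≤ ½ * (p + q) × ½ * (p + q) ℚ.≤ q
  midpoint p q p≤q =
    shift-≤ (ℚₚ.*-monoˡ-≤-nonNeg ½ p≤q)
      (solve 2 (λ p q → p :+ con ½ :* q := con ½ :* (p :+ q) :+ con ½ :* p) refl p q) ,
    shift-≤ (ℚₚ.*-monoˡ-≤-nonNeg ½ p≤q)
      (solve 2 (λ p q → con ½ :* (p :+ q) :+ con ½ :* q := q :+ con ½ :* p) refl p q)

  ½δ≤δ-suc : ∀ m → ½ * δ m ℚ.≤ δ (suc m)
  ½δ≤δ-suc m = begin
    ½ * δ m                              ≡⟨ cong (½ *_) (δ-double m) ⟨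
    ½ * (δ (double m) + δ (double m))    ≡⟨ solve 1 (λ d → con ½ :* (d :+ d) := d) refl (δ (double m)) ⟩
    δ (double m)                         ≤⟨ δ-antimono (ℕₚ.m≤n+m (suc m) m) ⟩
    δ (suc m)                            ∎
    where open ℚₚ.≤-Reasoning

module Segment {n} (a b : ℝ^ n) where

  open ℚ-Arithmetic
  open Gaps
  open Mixing
  open import Data.Rational.Base using (_+_; _*_; _-_; ∣_∣)
  open +-*-Solver using (solve; _:=_; _:+_; _:*_; _:-_; con)

  -- Between the indices k and 0 each sequence moves by at most `δ k + δ 0`, which is at most 2; two
  -- sequences give the constant 4.
  distance-bound : ∀ x y k → ∣ seq y k - seq x k ∣ ℚ.≤ ∣ seq y 0 - seq x 0 ∣ + (1ℚ + 1ℚ + (1ℚ + 1ℚ))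
  distance-bound x y k = ∣-∣-intro {seq y k} {seq x k}
    (shift-≤ (seq-≤ y k 0 ⊕ seq-≤ x 0 k ⊕ ∣-∣-elim {Y₀} {X₀} ℚₚ.≤-refl ⊕ δk≤1 ⊕ δk≤1)
      (solve 6 (λ X Y X₀ Y₀ d r →
        Y :+ ((Y₀ :+ (d :+ con 1ℚ)) :+ ((X :+ (con 1ℚ :+ d)) :+ ((X₀ :+ r) :+ (con 1ℚ :+ con 1ℚ))))
        := (X :+ (r :+ (con 1ℚ :+ con 1ℚ :+ (con 1ℚ :+ con 1ℚ)))) :+ (Y :+ (X₀ :+ (Y₀ :+ (d :+ d)))))
        refl (seq x k) (seq y k) X₀ Y₀ (δ k) r))
    (shift-≤ (seq-≤ x k 0 ⊕ seq-≤ y 0 k ⊕ ∣-∣-elim {X₀} {Y₀} (ℚₚ.≤-reflexive (∣-∣-sym X₀ Y₀)) ⊕ δk≤1 ⊕ δk≤1)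
      (solve 6 (λ Y X Y₀ X₀ d r →
        Y :+ ((Y₀ :+ (d :+ con 1ℚ)) :+ ((X :+ (con 1ℚ :+ d)) :+ ((X₀ :+ r) :+ (con 1ℚ :+ con 1ℚ))))
        := (X :+ (r :+ (con 1ℚ :+ con 1ℚ :+ (con 1ℚ :+ con 1ℚ)))) :+ (Y :+ (X₀ :+ (Y₀ :+ (d :+ d)))))
        refl (seq x k) (seq y k) X₀ Y₀ (δ k) r))
    where
    X₀ = seq x 0
    Y₀ = seq y 0
    r = ∣ Y₀ - X₀ ∣
    δk≤1 : δ k ℚ.≤ 1ℚ
    δk≤1 = δ-antimono {0} {k} ℕ.z≤n

  abstract
    -- One constant for all coordinates and all indices. In `mix-path-≤` the distance pays for the
    -- movement of the parameter and the extra 1 for that of the endpoints.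
    spread : ∃[ B ] ∀ i k → ∣ seq (b i) k - seq (a i) k ∣ + 1ℚ ℚ.≤ ι (suc B)
    spread = eventually-all (λ i l≤m h k → ℚₚ.≤-trans (h k) (ι-mono (ℕ.s≤s l≤m))) λ i →
      let r = ∣ seq (b i) 0 - seq (a i) 0 ∣ + (1ℚ + 1ℚ + (1ℚ + 1ℚ))
          B , r+1≤ = ι-bound (r + 1ℚ)
      in B , λ k → ℚₚ.≤-trans (ℚₚ.+-monoˡ-≤ 1ℚ (distance-bound (a i) (b i) k)) r+1≤

  B : ℕ
  B = proj₁ spread

  C : ℚ
  C = ι (suc B)

  -- `suc (M k)` is `suc B * suc k`, so `C * δ (M k)` is exactly `δ k`. This is why the Lipschitz
  -- constant `C` is taken to be a natural number.
  M : ℕ → ℕ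
  M k = k ℕ.+ B ℕ.* suc k

  k≤M : ∀ k → k ≤ M k
  k≤M k = ℕₚ.m≤m+n k _

  spread-* : ∀ {e} → 0ℚ ℚ.≤ e → ∀ i k → e * ∣ seq (b i) k - seq (a i) k ∣ + e ℚ.≤ e * C
  spread-* {e} 0≤e i k = begin
    e * s + e      ≡⟨ solve 2 (λ e s → e :* s :+ e := e :* (s :+ con 1ℚ)) refl e s ⟩
    e * (s + 1ℚ)   ≤⟨ ℚₚ.*-monoˡ-≤-nonNeg e {{ℚ.nonNegative 0≤e}} (proj₂ spread i k) ⟩
    e * C          ∎
    where
    open ℚₚ.≤-Reasoning
    s = ∣ seq (b i) k - seq (a i) k ∣

  -- A real in [0,1] all of whose approximations lie in [0,1], so that each approximation of the
  -- path is itself a convex combination. Rational parameters would not do, since the bisection ends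
  -- at a limit.
  record Parameter : Set where
    field
      at      : ℕ → ℚ
      at≥0    : ∀ k → 0ℚ ℚ.≤ at k
      at≤1    : ∀ k → at k ℚ.≤ 1ℚ
      regular : ∀ j k → ∣ at j - at k ∣ ℚ.≤ δ j + δ k

  open Parameter

  mix-path : Parameter → Fin n → ℕ → ℚ
  mix-path τ i k = mix (at τ k) (seq (a i) k) (seq (b i) k)

  mix-path-≤ : ∀ τ i j k → mix-path τ i j ℚ.≤ mix-path τ i k + (δ j + δ k) * C
  mix-path-≤ τ i j k = begin
    mix t A B′                                    ≤⟨ mix-mono (at≥0 τ j) (at≤1 τ j) (seq-≤ (a i) j k) (seq-≤ (b i) j k) ⟩
    mix t (A′ + e) (B″ + e)                       ≡⟨ mix-+ t A′ B″ e ⟩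
    mix t A′ B″ + e                               ≤⟨ ℚₚ.+-monoˡ-≤ e (mix-Lipschitz t (at τ k) A′ B″ (regular τ j k)) ⟩
    mix (at τ k) A′ B″ + e * ∣ B″ - A′ ∣ + e      ≡⟨ ℚₚ.+-assoc (mix (at τ k) A′ B″) _ e ⟩
    mix (at τ k) A′ B″ + (e * ∣ B″ - A′ ∣ + e)    ≤⟨ ℚₚ.+-monoʳ-≤ (mix (at τ k) A′ B″) (spread-* 0≤e i k) ⟩
    mix (at τ k) A′ B″ + e * C                    ∎
    where
    open ℚₚ.≤-Reasoning
    t = at τ j
    A = seq (a i) j
    B′ = seq (b i) j
    A′ = seq (a i) k
    B″ = seq (b i) k
    e = δ j + δ k
    0≤e = ℚₚ.<⇒≤ (ℚₚ.+-mono-< (δ-pos j) (δ-pos k))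

  -- Convex combinations are regular only up to the factor C; reading them along M absorbs it.
  path : Parameter → ℝ^ n
  path τ i .seq k = mix-path τ i (M k)
  path τ i .ℝ.regular j k = ∣-∣-intro (half j k)
    (subst (λ e → mix-path τ i (M k) ℚ.≤ mix-path τ i (M j) + e) (ℚₚ.+-comm (δ k) (δ j)) (half k j))
    where
    scale : ∀ j k → (δ (M j) + δ (M k)) * C ≡ δ j + δ k
    scale j k = trans (solve 3 (λ d e c → (d :+ e) :* c := c :* d :+ c :* e) refl (δ (M j)) (δ (M k)) C)
                      (cong₂ _+_ (δ-scale B j) (δ-scale B k))
    half : ∀ j k → mix-path τ i (M j) ℚ.≤ mix-path τ i (M k) + (δ j + δ k)
    half j k = subst (λ e → mix-path τ i (M j) ℚ.≤ mix-path τ i (M k) + e) (scale j k)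
                     (mix-path-≤ τ i (M j) (M k))

  path-Gap : ∀ τ {i j q} → Gap (a i) (a j) q → Gap (b i) (b j) q → Gap (path τ i) (path τ j) q
  path-Gap τ {i} {j} {q} (gap ε 0<ε N h) (gap ε′ 0<ε′ N′ h′) =
    gap (ε ℚ.⊓ ε′) (⊓-pos 0<ε 0<ε′) (N ℕ.⊔ N′) λ k N≤k →
      let m = M k
          N≤m = ℕₚ.≤-trans N≤k (k≤M k)
          t = at τ m
      in begin
      q + (ε ℚ.⊓ ε′)            ≡⟨ mix-const t _ ⟨
      mix t (q + (ε ℚ.⊓ ε′)) (q + (ε ℚ.⊓ ε′))
        ≤⟨ mix-mono (at≥0 τ m) (at≤1 τ m)
             (ℚₚ.≤-trans (ℚₚ.+-monoʳ-≤ q (ℚₚ.p⊓q≤p ε ε′)) (h m (ℕₚ.m⊔n≤o⇒m≤o N N′ N≤m)))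
             (ℚₚ.≤-trans (ℚₚ.+-monoʳ-≤ q (ℚₚ.p⊓q≤q ε ε′)) (h′ m (ℕₚ.m⊔n≤o⇒n≤o N N′ N≤m))) ⟩
      mix t (seq (a i) m - seq (a j) m) (seq (b i) m - seq (b j) m)
        ≡⟨ mix-- t (seq (a i) m) (seq (b i) m) (seq (a j) m) (seq (b j) m) ⟩
      seq (path τ i) k - seq (path τ j) k ∎
    where
    open ℚₚ.≤-Reasoning
    ⊓-pos : ∀ {p q} → 0ℚ ℚ.< p → 0ℚ ℚ.< q → 0ℚ ℚ.< p ℚ.⊓ q
    ⊓-pos {p} {q} 0<p 0<q with ℚₚ.⊓-sel p q
    ... | inj₁ eq = subst (0ℚ ℚ.<_) (sym eq) 0<p
    ... | inj₂ eq = subst (0ℚ ℚ.<_) (sym eq) 0<q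

  path-near : ∀ σ τ {e} k → ∣ at σ (M k) - at τ (M k) ∣ ℚ.≤ e → ∀ i →
              seq (path σ i) k ℚ.≤ seq (path τ i) k + e * C
  path-near σ τ {e} k h i = begin
    mix-path σ i m                            ≤⟨ mix-Lipschitz (at σ m) (at τ m) (seq (a i) m) (seq (b i) m) h ⟩
    mix-path τ i m + e * s                    ≡⟨ cong (mix-path τ i m +_) (ℚₚ.+-identityʳ (e * s)) ⟨
    mix-path τ i m + (e * s + 0ℚ)             ≤⟨ ℚₚ.+-monoʳ-≤ (mix-path τ i m) (ℚₚ.+-monoʳ-≤ (e * s) 0≤e) ⟩
    mix-path τ i m + (e * s + e)              ≤⟨ ℚₚ.+-monoʳ-≤ (mix-path τ i m) (spread-* 0≤e i m) ⟩
    mix-path τ i m + e * C                    ∎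
    where
    open ℚₚ.≤-Reasoning
    m = M k
    s = ∣ seq (b i) m - seq (a i) m ∣
    0≤e = ℚₚ.≤-trans (ℚₚ.0≤∣p∣ (at σ m - at τ m)) h

  constant : ∀ t → 0ℚ ℚ.≤ t → t ℚ.≤ 1ℚ → Parameter
  constant t 0≤t t≤1 .at _ = t
  constant t 0≤t t≤1 .at≥0 _ = 0≤t
  constant t 0≤t t≤1 .at≤1 _ = t≤1
  constant t 0≤t t≤1 .regular = ℝ.regular (fromℚ t)

module Neighbourhoods where

  open ℚ-Arithmetic
  open Gaps
  open import Data.Rational.Base using (_+_; _*_; _-_)
  open +-*-Solver using (solve; _:=_; _:+_; _:*_; _:-_; con)

  -- The slack `δ k + δ k` tends to 0, so the hypotheses bound the distance by e in the limit, while
  -- the radius is at least ε > e. The room ε - e is spent on four copies of `δ k`, two for each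
  -- half.
  near⇒Ball : ∀ {n} {x y : ℝ^ n} {r e ε} N →
          (∀ k → N ≤ k → ε ℚ.≤ seq r k) → e ℚ.< ε →
          (∀ i k → N ≤ k → seq (x i) k ℚ.≤ seq (y i) k + (e + (δ k + δ k))) →
          (∀ i k → N ≤ k → seq (y i) k ℚ.≤ seq (x i) k + (e + (δ k + δ k))) →
          y ∈ Ball x r
  near⇒Ball {x = x} {y} {r} {e} {ε} N ε≤r e<ε x≤y y≤x i =
    let k , N≤k , small = δ-small (½-pos (pos-diff e<ε)) N in
    (k , close x y x≤y k N≤k small) , (k , close y x y≤x k N≤k small)
    where
    close : ∀ x y → (∀ i k → N ≤ k → seq (x i) k ℚ.≤ seq (y i) k + (e + (δ k + δ k))) →
            ∀ k → N ≤ k → δ k + δ k ℚ.< ½ * (ε - e) →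
            seq (x i -ᵣ y i) k + δ k ℚ.< seq r k - δ k
    close x y h k N≤k small = shift-<
      (ℚₚ.+-mono-<-≤ (ℚₚ.+-mono-< small small)
        (ε≤r k N≤k ⊕ h i K (ℕₚ.≤-trans N≤k (k≤double k)) ⊕ ℚₚ.≤-reflexive (δ-double k) ⊕ ℚₚ.<⇒≤ (δ-pos k)))
      (solve 7 (λ X Y d D e ε R →
        (X :- Y :+ d) :+ ((con ½ :* (ε :- e) :+ con ½ :* (ε :- e)) :+ (R :+ ((Y :+ (e :+ (D :+ D))) :+ (d :+ d))))
        := (R :- d) :+ (((d :+ d) :+ (d :+ d)) :+ (ε :+ (X :+ ((D :+ D) :+ con 0ℚ)))))
        refl (seq (x i) K) (seq (y i) K) (δ k) (δ K) e ε (seq r k))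
      where K = double k

-- Bisection along a segment

module Connectedness where

  open ℚ-Arithmetic
  open Gaps
  open Mixing
  open Neighbourhoods
  open import Data.Rational.Base using (_+_; _*_; _-_; ∣_∣)
  open +-*-Solver using (solve; _:=_; _:+_; _:*_; _:-_; con)

  HalfSpaces : ∀ {n} → (Fin n → Fin n → ℚ → Set) → Pred (ℝ^ n) 0ℓ
  HalfSpaces H z = ∀ {i j q} → H i j q → Gap (z i) (z j) q

  module Bisection {n} (U V : Pred (ℝ^ n) 0ℓ) (openU : IsOpen U) (openV : IsOpen V) (a b : ℝ^ n)
                   (cover : ∀ τ → U (Segment.path a b τ) ⊎ V (Segment.path a b τ))
                   (a∈U : U a) (b∈V : V b) where

    open Segment a b

    -- The width bound is `δ m`, weaker than what halving yields, because it makes the left ends a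
    -- regular sequence as they stand; see `limit`.
    record Bracket (m : ℕ) : Set where
      field
        lo hi : ℚ
        0≤lo  : 0ℚ ℚ.≤ lo
        lo≤1  : lo ℚ.≤ 1ℚ
        0≤hi  : 0ℚ ℚ.≤ hi
        hi≤1  : hi ℚ.≤ 1ℚ
        lo≤hi : lo ℚ.≤ hi
        width : hi ℚ.≤ lo + δ m
        lo∈U  : U (path (constant lo 0≤lo lo≤1))
        hi∈V  : V (path (constant hi 0≤hi hi≤1))

    open Bracket

    -- At the parameters 0 and 1 the path is an endpoint read along `M`: another sequence for the
    -- same real point. It lies in every ball around the endpoint, so openness of W transfers
    -- membership.
    near-end : ∀ W → IsOpen W → ∀ c → W c → ∀ τ →
               (∀ i k → seq (path τ i) k ≡ seq (c i) (M k)) → W (path τ)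
    near-end W openW c c∈W τ eq =
      let r , r>0 , ball = openW c∈W
          gap ε 0<ε N h = >ᵣ⇒Gap {r} {0ℝ} r>0
      in ball (near⇒Ball {x = c} {path τ} {r} {0ℚ} {ε} N
           (λ k N≤k → shift-≤ (h k N≤k)
             (solve 2 (λ e r → e :+ (r :- con 0ℚ) := r :+ (con 0ℚ :+ e)) refl ε (seq r k)))
           0<ε
           (λ i k _ → ℚₚ.≤-trans (close i k (M k) (k≤M k))
             (ℚₚ.+-monoˡ-≤ (0ℚ + (δ k + δ k)) (ℚₚ.≤-reflexive (sym (eq i k)))))
           (λ i k _ → ℚₚ.≤-trans (ℚₚ.≤-reflexive (eq i k)) (close′ i k (M k) (k≤M k))))
      where
      close : ∀ i k m → k ≤ m → seq (c i) k ℚ.≤ seq (c i) m + (0ℚ + (δ k + δ k))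
      close i k m k≤m = shift-≤ (seq-≤ (c i) k m ⊕ δ-antimono k≤m)
        (solve 4 (λ X Y d e → X :+ ((Y :+ (d :+ e)) :+ d) := (Y :+ (con 0ℚ :+ (d :+ d))) :+ (X :+ e))
          refl (seq (c i) k) (seq (c i) m) (δ k) (δ m))
      close′ : ∀ i k m → k ≤ m → seq (c i) m ℚ.≤ seq (c i) k + (0ℚ + (δ k + δ k))
      close′ i k m k≤m = shift-≤ (seq-≤ (c i) m k ⊕ δ-antimono k≤m)
        (solve 4 (λ X Y d e → X :+ ((Y :+ (e :+ d)) :+ d) := (Y :+ (con 0ℚ :+ (d :+ d))) :+ (X :+ e))
          refl (seq (c i) m) (seq (c i) k) (δ k) (δ m))

    0≤1 : 0ℚ ℚ.≤ 1ℚ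
    0≤1 = ℚ.*≤* (ℤ.+≤+ ℕ.z≤n)

    path0∈U : U (path (constant 0ℚ ℚₚ.≤-refl 0≤1))
    path0∈U = near-end U openU a a∈U (constant 0ℚ ℚₚ.≤-refl 0≤1)
      λ i k → mix-0 (seq (a i) (M k)) (seq (b i) (M k))

    path1∈V : V (path (constant 1ℚ 0≤1 ℚₚ.≤-refl))
    path1∈V = near-end V openV b b∈V (constant 1ℚ 0≤1 ℚₚ.≤-refl)
      λ i k → mix-1 (seq (a i) (M k)) (seq (b i) (M k))

    initial : Bracket 0
    initial = record
      { lo = 0ℚ ; hi = 1ℚ ; 0≤lo = ℚₚ.≤-refl ; lo≤1 = 0≤1 ; 0≤hi = 0≤1 ; hi≤1 = ℚₚ.≤-refl
      ; lo≤hi = 0≤1 ; width = ℚₚ.≤-refl ; lo∈U = path0∈U ; hi∈V = path1∈V }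

    refine : ∀ {m} (β : Bracket m) → ∃[ β′ ] lo β ℚ.≤ lo {suc m} β′ × hi β′ ℚ.≤ hi β
    refine {m} β = decide (cover (constant mid 0≤mid mid≤1))
      where
      mid = ½ * (lo β + hi β)
      lo≤mid = proj₁ (midpoint (lo β) (hi β) (lo≤hi β))
      mid≤hi = proj₂ (midpoint (lo β) (hi β) (lo≤hi β))
      0≤mid = ℚₚ.≤-trans (0≤lo β) lo≤mid
      mid≤1 = ℚₚ.≤-trans mid≤hi (hi≤1 β)
      half = ℚₚ.*-monoˡ-≤-nonNeg ½ (width β)
      decide : U (path (constant mid 0≤mid mid≤1)) ⊎ V (path (constant mid 0≤mid mid≤1)) →
               ∃[ β′ ] lo β ℚ.≤ lo {suc m} β′ × hi β′ ℚ.≤ hi β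
      decide (inj₁ u) = record
        { lo = mid ; hi = hi β ; 0≤lo = 0≤mid ; lo≤1 = mid≤1 ; 0≤hi = 0≤hi β ; hi≤1 = hi≤1 β ; lo≤hi = mid≤hi
        ; width = shift-≤ (half ⊕ ½δ≤δ-suc m)
            (solve 4 (λ l h d e → h :+ (con ½ :* (l :+ d) :+ e)
                        := (con ½ :* (l :+ h) :+ e) :+ (con ½ :* h :+ con ½ :* d))
              refl (lo β) (hi β) (δ m) (δ (suc m)))
        ; lo∈U = u ; hi∈V = hi∈V β } , lo≤mid , ℚₚ.≤-refl
      decide (inj₂ v) = record
        { lo = lo β ; hi = mid ; 0≤lo = 0≤lo β ; lo≤1 = lo≤1 β ; 0≤hi = 0≤mid ; hi≤1 = mid≤1 ; lo≤hi = lo≤mid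
        ; width = shift-≤ (half ⊕ ½δ≤δ-suc m)
            (solve 4 (λ l h d e → con ½ :* (l :+ h) :+ (con ½ :* (l :+ d) :+ e)
                        := (l :+ e) :+ (con ½ :* h :+ con ½ :* d))
              refl (lo β) (hi β) (δ m) (δ (suc m)))
        ; lo∈U = lo∈U β ; hi∈V = v } , ℚₚ.≤-refl , mid≤hi

    bracket : ∀ m → Bracket m
    bracket zero    = initial
    bracket (suc m) = proj₁ (refine (bracket m))

    loₘ hiₘ : ℕ → ℚ
    loₘ m = lo (bracket m)
    hiₘ m = hi (bracket m)

    lo-mono : ∀ {j k} → j ℕ.≤′ k → loₘ j ℚ.≤ loₘ k
    lo-mono ℕ.≤′-refl = ℚₚ.≤-refl
    lo-mono (ℕ.≤′-step j≤k) = ℚₚ.≤-trans (lo-mono j≤k) (proj₁ (proj₂ (refine (bracket _))))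

    hi-antimono : ∀ {j k} → j ℕ.≤′ k → hiₘ k ℚ.≤ hiₘ j
    hi-antimono ℕ.≤′-refl = ℚₚ.≤-refl
    hi-antimono (ℕ.≤′-step j≤k) = ℚₚ.≤-trans (proj₂ (proj₂ (refine (bracket _)))) (hi-antimono j≤k)

    loⱼ≤hiₖ : ∀ j k → loₘ j ℚ.≤ hiₘ k
    loⱼ≤hiₖ j k with ℕₚ.≤-total j k
    ... | inj₁ j≤k = ℚₚ.≤-trans (lo-mono (ℕₚ.≤⇒≤′ j≤k)) (lo≤hi (bracket k))
    ... | inj₂ k≤j = ℚₚ.≤-trans (lo≤hi (bracket j)) (hi-antimono (ℕₚ.≤⇒≤′ k≤j))

    loⱼ≤loₖ+δₖ : ∀ j k → loₘ j ℚ.≤ loₘ k + δ k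
    loⱼ≤loₖ+δₖ j k = ℚₚ.≤-trans (loⱼ≤hiₖ j k) (width (bracket k))

    open Parameter

    limit : Parameter
    limit .at = loₘ
    limit .at≥0 k = 0≤lo (bracket k)
    limit .at≤1 k = lo≤1 (bracket k)
    limit .regular j k = ∣-∣-intro {loₘ j} {loₘ k}
      (shift-≤ (loⱼ≤loₖ+δₖ j k ⊕ ℚₚ.<⇒≤ (δ-pos j))
        (solve 4 (λ x y d e → x :+ ((y :+ e) :+ d) := (y :+ (d :+ e)) :+ (x :+ con 0ℚ))
          refl (loₘ j) (loₘ k) (δ j) (δ k)))
      (shift-≤ (loⱼ≤loₖ+δₖ k j ⊕ ℚₚ.<⇒≤ (δ-pos k))
        (solve 4 (λ y x d e → x :+ ((y :+ d) :+ e) := (y :+ (d :+ e)) :+ (x :+ con 0ℚ))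
          refl (loₘ j) (loₘ k) (δ j) (δ k)))

    -- Parameters at distance at most `δ m` from the limit give points at distance at most
    -- `δ m * C`, which is below the radius of the ball around the limit point once m is large.
    limit-open : ∀ W → IsOpen W → W (path limit) → (ρ : ℕ → Parameter) →
                 (∀ m k → m ≤ k → ∣ loₘ k - at (ρ m) k ∣ ℚ.≤ δ m) → ∃[ m ] W (path (ρ m))
    limit-open W openW c∈W ρ close =
      let r , r>0 , ball = openW c∈W
          gap ε 0<ε N h = >ᵣ⇒Gap {r} {0ℝ} r>0
          k₀ , _ , 2δ<ε = δ-small 0<ε 0
          -- With this index `δ m * C` equals `δ k₀`, and `δ k₀` is smaller than ε.
          m = M k₀
          e = δ m * C
          e≡δk₀ = trans (ℚₚ.*-comm (δ m) C) (δ-scale B k₀)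
          near : ∀ σ τ i k → ∣ at σ (M k) - at τ (M k) ∣ ℚ.≤ δ m →
                 seq (path σ i) k ℚ.≤ seq (path τ i) k + (e + (δ k + δ k))
          near σ τ i k h = shift-≤ (path-near σ τ k h i ⊕ ℚₚ.<⇒≤ (δ-pos k) ⊕ ℚₚ.<⇒≤ (δ-pos k))
            (solve 4 (λ x y e d → x :+ ((y :+ e) :+ (d :+ d)) := (y :+ (e :+ (d :+ d))) :+ (x :+ (con 0ℚ :+ con 0ℚ)))
              refl (seq (path σ i) k) (seq (path τ i) k) e (δ k))
          m≤ : ∀ {k} → N ℕ.⊔ m ≤ k → m ≤ M k
          m≤ h = ℕₚ.≤-trans (ℕₚ.m⊔n≤o⇒n≤o N m h) (k≤M _)
      in m , ball (near⇒Ball {x = path limit} {path (ρ m)} {r} {e} {ε} (N ℕ.⊔ m)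
           (λ k N≤k → shift-≤ (h k (ℕₚ.m⊔n≤o⇒m≤o N m N≤k))
             (solve 2 (λ e r → e :+ (r :- con 0ℚ) := r :+ (con 0ℚ :+ e)) refl ε (seq r k)))
           (subst (ℚ._< ε) (sym e≡δk₀) (shift-< (ℚₚ.+-mono-<-≤ 2δ<ε (ℚₚ.<⇒≤ (δ-pos k₀)))
             (solve 2 (λ d e → d :+ (e :+ d) := e :+ ((d :+ d) :+ con 0ℚ)) refl (δ k₀) ε)))
           (λ i k N≤k → near limit (ρ m) i k (close m (M k) (m≤ N≤k)))
           (λ i k N≤k → near (ρ m) limit i k
             (subst (ℚ._≤ δ m) (∣-∣-sym (loₘ (M k)) (at (ρ m) (M k))) (close m (M k) (m≤ N≤k)))))

    left right : ℕ → Parameter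
    left  m = constant (loₘ m) (0≤lo (bracket m)) (lo≤1 (bracket m))
    right m = constant (hiₘ m) (0≤hi (bracket m)) (hi≤1 (bracket m))

    left-near : ∀ m k → m ≤ k → ∣ loₘ k - loₘ m ∣ ℚ.≤ δ m
    left-near m k m≤k = ∣-∣-intro {loₘ k} {loₘ m}
      (loⱼ≤loₖ+δₖ k m)
      (shift-≤ (lo-mono (ℕₚ.≤⇒≤′ m≤k) ⊕ ℚₚ.<⇒≤ (δ-pos m))
        (solve 3 (λ l l′ d → l :+ (l′ :+ d) := (l′ :+ d) :+ (l :+ con 0ℚ)) refl (loₘ m) (loₘ k) (δ m)))

    right-near : ∀ m k → m ≤ k → ∣ loₘ k - hiₘ m ∣ ℚ.≤ δ m
    right-near m k m≤k = ∣-∣-intro {loₘ k} {hiₘ m}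
      (ℚₚ.≤-trans (loⱼ≤hiₖ k m) (shift-≤ (ℚₚ.<⇒≤ (δ-pos m))
        (solve 2 (λ h d → h :+ d := (h :+ d) :+ con 0ℚ) refl (hiₘ m) (δ m))))
      (ℚₚ.≤-trans (width (bracket m)) (ℚₚ.+-monoˡ-≤ (δ m) (lo-mono (ℕₚ.≤⇒≤′ m≤k))))

    -- Whichever set contains the limit also contains a late bracket end of the opposite kind: right
    -- ends are in V by construction, left ends in U.
    meeting-point : ∃[ τ ] U (path τ) × V (path τ)
    meeting-point = decide (cover limit)
      where
      at-right : ∃[ m ] U (path (right m)) → ∃[ τ ] U (path τ) × V (path τ)
      at-right (m , u) = right m , u , hi∈V (bracket m)
      at-left : ∃[ m ] V (path (left m)) → ∃[ τ ] U (path τ) × V (path τ)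
      at-left (m , v) = left m , lo∈U (bracket m) , v
      decide : U (path limit) ⊎ V (path limit) → ∃[ τ ] U (path τ) × V (path τ)
      decide (inj₁ c∈U) = at-right (limit-open U openU c∈U right right-near)
      decide (inj₂ c∈V) = at-left (limit-open V openV c∈V left left-near)

  HalfSpaces-connected : ∀ {n} (H : Fin n → Fin n → ℚ → Set) → IsConnected (HalfSpaces H)
  HalfSpaces-connected H U V openU openV S⊆U∪V (a , a∈S , a∈U) (b , b∈S , b∈V) =
    let τ , u , v = meeting-point in path τ , path∈S τ , u , v
    where
    open Segment a b
    path∈S : ∀ τ → HalfSpaces H (path τ)
    path∈S τ h = path-Gap τ (a∈S h) (b∈S h)
    open Bisection U V openU openV a b (λ τ → S⊆U∪V (path∈S τ)) a∈U b∈V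

-- Words, fibres and layouts

minimise : {Q : U.Pred (Fin n) ℓ} → U.Decidable Q → (T : Fin n → ℕ) → ∃ Q →
           ∃[ x ] Q x × (∀ y → Q y → T x ≤ T y)
minimise {Q = Q} Q? T (x , q) = go x q (<-wellFounded (T x))
  where
  go : ∀ x → Q x → Acc ℕ._<_ (T x) → ∃[ x ] Q x × (∀ y → Q y → T x ≤ T y)
  go x q (acc rs) with any? (λ y → Q? y ×-dec (T y ℕₚ.<? T x))
  ... | yes (y , qy , lt) = go y qy (rs lt)
  ... | no none = x , q , λ y qy → ℕₚ.≮⇒≥ λ lt → none (y , qy , lt)

-- The arcs, expressed through f alone: a and b are consecutive in a fibre of f.
Next : (Fin n → Fin n) → Rel (Fin n) _
Next f a b = f a ≡ f b × a Fin.< b × (∀ c → f c ≡ f b → c Fin.< b → c Fin.≤ a)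

module _ {n} (f : Fin n → Fin n) where

  Next? : Decidable (Next f)
  Next? a b = (f a Finₚ.≟ f b) ×-dec (a Finₚ.<? b) ×-dec
    all? λ c → (f c Finₚ.≟ f b) →-dec ((c Finₚ.<? b) →-dec (c Finₚ.≤? a))

  Next-injˡ : ∀ {a a′ b} → Next f a b → Next f a′ b → a ≡ a′
  Next-injˡ (e , lt , mx) (e′ , lt′ , mx′) = Finₚ.≤-antisym (mx′ _ e lt) (mx _ e′ lt′)

  Next-injʳ : ∀ {a b b′} → Next f a b → Next f a b′ → b ≡ b′
  Next-injʳ {a} {b} {b′} (e , lt , mx) (e′ , lt′ , mx′) with Finₚ.<-cmp b b′
  ... | tri< b<b′ _ _ = contradiction (mx′ b (trans (sym e) e′) b<b′) (ℕₚ.<⇒≱ lt)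
  ... | tri≈ _ eq _ = eq
  ... | tri> _ _ b′<b = contradiction (mx b′ (trans (sym e′) e) b′<b) (ℕₚ.<⇒≱ lt′)

  predecessor : ∀ {m i} → f m ≡ f i → m Fin.< i → ∃[ a ] Next f a i
  predecessor {m} {i} e lt =
    -- Minimising `n ∸ toℕ c` selects the largest c.
    let a , (e′ , lt′) , mx = minimise (λ c → (f c Finₚ.≟ f i) ×-dec (c Finₚ.<? i)) (λ c → n ℕ.∸ toℕ c) (m , e , lt)
    in a , e′ , lt′ , λ c e″ lt″ → ℕₚ.∸-cancelʳ-≤ (ℕₚ.<⇒≤ (toℕ<n c)) (mx c (e″ , lt″))

module Positions {n} (w : Permutation′ n) where

  pos word : Fin n → Fin n
  pos i = w ⟨$⟩ˡ i
  word p = w ⟨$⟩ʳ p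

  word-pos : ∀ i → word (pos i) ≡ i
  word-pos i = Perm.inverseʳ w

  pos-word : ∀ p → pos (word p) ≡ p
  pos-word p = Perm.inverseˡ w

  pos-injective : ∀ {i j} → pos i ≡ pos j → i ≡ j
  pos-injective {i} {j} eq = trans (sym (word-pos i)) (trans (cong word eq) (word-pos j))

  pos-rec : (P : Fin n → Set ℓ) → (∀ i → (∀ j → pos j Fin.< pos i → P j) → P i) → ∀ i → P i
  pos-rec P step i = go i (<-wellFounded (toℕ (pos i)))
    where
    go : ∀ i → Acc ℕ._<_ (toℕ (pos i)) → P i
    go i (acc rs) = step i λ j lt → go j (rs lt)

-- The combinatorial content of a diagram, with arcs read off from `f`. Regions yield layouts
-- (`IsShi.layout`), parking functions yield layouts (`Construction`), and layouts yield regions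
-- (`Realisation`).
record Layout {n} (f : Fin n → Fin n) (w : Permutation′ n) : Set where
  open Positions w
  field
    origin     : ∀ i → (f i ≡ pos i × (∀ k → f k ≡ f i → i Fin.≤ k))
                     ⊎ (∃[ a ] Next f a i × pos a Fin.< pos i)
    nonnesting : ∀ {a b c d} → Next f a b → Next f c d →
                 pos a Fin.≤ pos c → pos d Fin.≤ pos b → a ≡ c

  Next⇒pos< : ∀ {a b} → Next f a b → pos a Fin.< pos b
  Next⇒pos< {a} {b} nx with origin b
  ... | inj₁ (_ , min) = contradiction (min a (proj₁ nx)) (ℕₚ.<⇒≱ (proj₁ (proj₂ nx)))
  ... | inj₂ (a′ , nx′ , lt) = subst (λ z → pos z Fin.< pos b) (Next-injˡ f nx′ nx) lt

  first : ∀ i → ∃[ m ] f m ≡ f i × f m ≡ pos m × (∀ k → f k ≡ f m → m Fin.≤ k)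
  first = pos-rec _ λ i rec → step i rec (origin i)
    where
    step : ∀ i → (∀ j → pos j Fin.< pos i → ∃[ m ] f m ≡ f j × f m ≡ pos m × (∀ k → f k ≡ f m → m Fin.≤ k)) → _ →
           ∃[ m ] f m ≡ f i × f m ≡ pos m × (∀ k → f k ≡ f m → m Fin.≤ k)
    step i rec (inj₁ (e , min)) = i , refl , e , min
    step i rec (inj₂ (a , nx , lt)) =
      let m , e , rest = rec a lt in m , trans e (proj₁ nx) , rest

  f≤pos : ∀ i → f i Fin.≤ pos i
  f≤pos = pos-rec _ λ i rec → step i rec (origin i)
    where
    step : ∀ i → (∀ j → pos j Fin.< pos i → f j Fin.≤ pos j) → _ → f i Fin.≤ pos i
    step i rec (inj₁ (e , _)) = Finₚ.≤-reflexive e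
    step i rec (inj₂ (a , nx , lt)) = subst (Fin._≤ pos i) (proj₁ nx) (ℕₚ.≤-trans (rec a lt) (ℕₚ.<⇒≤ lt))

  start-unique : ∀ {i m} → (∀ k → f k ≡ f i → i Fin.≤ k) → f m ≡ f i → (∀ k → f k ≡ f m → m Fin.≤ k) → m ≡ i
  start-unique min e min′ = Finₚ.≤-antisym (min′ _ (sym e)) (min _ e)

  -- For the least letter of a fibre, `f` alone dictates the position; this settles the letters that
  -- open a chain when two layouts are compared.
  start-pos : ∀ {i} → (∀ k → f k ≡ f i → i Fin.≤ k) → pos i ≡ f i
  start-pos {i} min =
    let m , e , at , min′ = first i
        m≡i = start-unique min e min′
    in trans (cong pos (sym m≡i)) (trans (sym at) e)

-- Uniqueness of the word of a layout

module LayoutUniqueness {n} {f : Fin n → Fin n} {w w′ : Permutation′ n}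
                        (L : Layout f w) (L′ : Layout f w′) where
  open Layout
  open Positions
  open ≡-Reasoning

  private
    agree-below : ∀ {w w′ : Permutation′ n} {p : Fin n} → (∀ q → q Fin.< p → word w q ≡ word w′ q) →
                  ∀ i → pos w i Fin.< p → pos w′ i ≡ pos w i
    agree-below {w} {w′} rec i lt = begin
      pos w′ i                      ≡⟨ cong (pos w′) (word-pos w i) ⟨
      pos w′ (word w (pos w i))     ≡⟨ cong (pos w′) (rec _ lt) ⟩
      pos w′ (word w′ (pos w i))    ≡⟨ pos-word w′ _ ⟩
      pos w i                       ∎

    -- If the letter stood before p in the other word, it would have that earlier position in both,
    -- since the words agree there.
    not-before : ∀ {w w′ : Permutation′ n} {p : Fin n} → (∀ q → q Fin.< p → word w q ≡ word w′ q) →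
                 ∀ i → pos w i ≡ p → p Fin.≤ pos w′ i
    not-before {w} {w′} {p} rec i at = ℕₚ.≮⇒≥ λ lt →
      ℕₚ.<-irrefl (cong toℕ (trans (sym (agree-below {w′} {w} (λ q q<p → sym (rec q q<p)) i lt)) at)) lt

  -- At the first position where the words differ, both letters continue earlier
  -- chains; the one whose predecessor is further left comes too late in the
  -- other word, where its arc contains the other arc.
  word-unique : ∀ p → word w p ≡ word w′ p
  word-unique p = go p (<-wellFounded (toℕ p))
    where
    go : ∀ p → Acc ℕ._<_ (toℕ p) → word w p ≡ word w′ p
    go p (acc rs) = compare (origin L u) (origin L′ v)
      where
      rec : ∀ q → q Fin.< p → word w q ≡ word w′ q
      rec q lt = go q (rs lt)
      rec′ : ∀ q → q Fin.< p → word w′ q ≡ word w q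
      rec′ q lt = sym (rec q lt)
      u v : Fin n
      u = word w p
      v = word w′ p
      pu : pos w u ≡ p
      pu = pos-word w p
      pv : pos w′ v ≡ p
      pv = pos-word w′ p
      compare : _ → _ → u ≡ v
      compare (inj₁ (e , min)) _ =
        pos-injective w′ (trans (start-pos L′ min) (trans e (trans pu (sym pv))))
      compare _ (inj₁ (e , min)) =
        pos-injective w (trans pu (trans (trans (sym pv) (sym e)) (sym (start-pos L min))))
      compare (inj₂ (a , nx , lt)) (inj₂ (c , nx′ , lt′)) with ℕₚ.≤-total (toℕ (pos w a)) (toℕ (pos w c))
      ... | inj₁ a≤c = Next-injʳ f nx (subst (λ z → Next f z v) (sym a≡c) nx′)
        where
        a≡c : a ≡ c
        a≡c = nonnesting L′ nx nx′
          (subst₂ Fin._≤_ (sym (agree-below {w} {w′} rec a (subst (pos w a Fin.<_) pu lt)))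
                          (agree-below {w′} {w} rec′ c (subst (pos w′ c Fin.<_) pv lt′)) a≤c)
          (subst (Fin._≤ pos w′ u) (sym pv) (not-before {w} {w′} rec u pu))
      ... | inj₂ c≤a = Next-injʳ f nx (subst (λ z → Next f z v) (sym a≡c) nx′)
        where
        a≡c : a ≡ c
        a≡c = sym (nonnesting L nx′ nx c≤a
          (subst (Fin._≤ pos w v) (sym pu) (not-before {w′} {w} rec′ v pv)))

  pos-unique : ∀ i → pos w i ≡ pos w′ i
  pos-unique i = begin
    pos w i                     ≡⟨ pos-word w′ (pos w i) ⟨
    pos w′ (word w′ (pos w i))  ≡⟨ cong (pos w′) (word-unique (pos w i)) ⟨
    pos w′ (word w (pos w i))   ≡⟨ cong (pos w′) (word-pos w i) ⟩
    pos w′ i                    ∎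

-- Chains of a diagram

injection⇒≤length : ∀ {m} {P : U.Pred (Fin n) ℓ} (P? : U.Decidable P) (g : Fin m → Fin n) →
                    Injective _≡_ _≡_ g → (∀ p → P (g p)) → m ≤ length (filter P? (allFin n))
injection⇒≤length {n = n} {m = m} P? g g-inj Pg = Finₚ.injective⇒≤ {f = index ∘ mem} inj
  where
  xs = filter P? (allFin n)
  mem : ∀ p → g p ∈ₗ xs
  mem p = ∈-filter⁺ P? (∈-allFin (g p)) (Pg p)
  inj : Injective _≡_ _≡_ (index ∘ mem)
  inj {p} {q} eq = g-inj (trans (lookup-index (mem p)) (trans (cong (lookup xs) eq) (sym (lookup-index (mem q)))))

-- The diagram over an arbitrary relation `I`, which unfolds to the given one for `InitialArc R`.
-- Geometry enters only through the properties collected in `IsShi`.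
module ShiDiagram {n ℓ} (w : Permutation′ n) (I : Rel (Fin n) ℓ) where

  open Positions w

  ContainsAnother : Rel (Fin n) ℓ
  ContainsAnother i l =
    ∃[ j ] ∃[ k ] I j k × (j , k) ≢ (i , l) × pos i Fin.≤ pos j × pos k Fin.≤ pos l

  Arc : Rel (Fin n) ℓ
  Arc i l = I i l × ¬ ContainsAnother i l

  SameChain : Rel (Fin n) ℓ
  SameChain = EqClosure Arc

  IsLeftmost : Rel (Fin n) ℓ
  IsLeftmost m i = SameChain i m × (∀ k → SameChain i k → pos m Fin.≤ pos k)

  ChainStarts : (Fin n → Fin n) → Set ℓ
  ChainStarts f = ∀ i → ∃[ m ] IsLeftmost m i × f i ≡ pos m

  Contains : Rel (Fin n) ℓ → Rel (Fin n) ℓ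
  Contains A i l = ∃[ j ] ∃[ k ] A j k × pos i Fin.≤ pos j × pos k Fin.≤ pos l

  -- `I-up` reflects that a pair further apart in the word has the larger difference: if i is left
  -- of j and l right of k, then the difference for i and l also exceeds 1. Hence the minimal arcs
  -- determine all the others.
  record IsShi : Set ℓ where
    field
      I?     : Decidable I
      I⇒<    : ∀ {i j} → I i j → i Fin.< j
      I⇒pos< : ∀ {i j} → I i j → pos i Fin.< pos j
      I-up   : ∀ {i l} → i Fin.< l → Contains I i l → I i l

    private
      _≟₂_ = ≡-dec (Finₚ._≟_ {n}) (Finₚ._≟_ {n})

    ContainsAnother? : Decidable ContainsAnother
    ContainsAnother? i l = any? λ j → any? λ k →
      I? j k ×-dec ¬? ((j , k) ≟₂ (i , l)) ×-dec (pos i Finₚ.≤? pos j) ×-dec (pos k Finₚ.≤? pos l)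

    Arc? : Decidable Arc
    Arc? i l = I? i l ×-dec ¬? (ContainsAnother? i l)

    Arc-minimal : ∀ {a b c d} → Arc a b → I c d → pos a Fin.≤ pos c → pos d Fin.≤ pos b → (c , d) ≡ (a , b)
    Arc-minimal {a} {b} {c} {d} (_ , none) cd ac db with (c , d) ≟₂ (a , b)
    ... | yes eq = eq
    ... | no neq = contradiction (c , d , cd , neq , ac , db) none

    Arc-injˡ : ∀ {a a′ b} → Arc a b → Arc a′ b → a ≡ a′
    Arc-injˡ {a} {a′} {b} ab a′b with ℕₚ.≤-total (toℕ (pos a)) (toℕ (pos a′))
    ... | inj₁ le = sym (cong proj₁ (Arc-minimal ab (proj₁ a′b) le ℕₚ.≤-refl))
    ... | inj₂ ge = cong proj₁ (Arc-minimal a′b (proj₁ ab) ge ℕₚ.≤-refl)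

    Arc-injʳ : ∀ {a b b′} → Arc a b → Arc a b′ → b ≡ b′
    Arc-injʳ {a} {b} {b′} ab ab′ with ℕₚ.≤-total (toℕ (pos b)) (toℕ (pos b′))
    ... | inj₁ le = cong proj₂ (Arc-minimal ab′ (proj₁ ab) ℕₚ.≤-refl le)
    ... | inj₂ ge = sym (cong proj₂ (Arc-minimal ab (proj₁ ab′) ℕₚ.≤-refl ge))

    -- Replacing an arc by a different one inside it shortens the distance between its ends in the
    -- word, so the descent stops, and it stops at a minimal arc.
    Contains-Arc : ∀ {i l} → I i l → Contains Arc i l
    Contains-Arc {i} {l} il = go i l il (<-wellFounded _)
      where
      go : ∀ i l → I i l → Acc ℕ._<_ (toℕ (pos l) ℕ.∸ toℕ (pos i)) → Contains Arc i l
      go i l il (acc rs) with ContainsAnother? i l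
      ... | no none = i , l , (il , none) , ℕₚ.≤-refl , ℕₚ.≤-refl
      ... | yes (j , k , jk , neq , ij , kl) =
        let a , b , ab , ja , bk = go j k jk (rs shorter)
        in a , b , ab , ℕₚ.≤-trans ij ja , ℕₚ.≤-trans bk kl
        where
        shorter : toℕ (pos k) ℕ.∸ toℕ (pos j) ℕ.< toℕ (pos l) ℕ.∸ toℕ (pos i)
        -- Either the left ends differ and the left end moves strictly inwards, or they coincide and
        -- then the right end does.
        shorter with toℕ (pos i) ℕₚ.<? toℕ (pos j)
        ... | yes i<j = ℕₚ.<-≤-trans
                (ℕₚ.∸-monoʳ-< i<j (ℕₚ.<⇒≤ (I⇒pos< jk)))
                (ℕₚ.∸-monoˡ-≤ (toℕ (pos i)) kl)
        ... | no i≮j = ℕₚ.≤-<-trans (ℕₚ.∸-monoʳ-≤ (toℕ (pos k)) ij)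
                (ℕₚ.∸-monoˡ-< k<l (ℕₚ.≤-trans ij (ℕₚ.<⇒≤ (I⇒pos< jk))))
          where
          j≡i : j ≡ i
          j≡i = pos-injective (Finₚ.≤-antisym (ℕₚ.≮⇒≥ i≮j) ij)
          k<l : pos k Fin.< pos l
          k<l = ℕₚ.≤∧≢⇒< kl λ eq → neq (cong₂ _,_ j≡i (pos-injective (toℕ-injective eq)))

    -- By `Arc-injˡ` there is at most one way to follow arcs leftwards, so each letter has one root.
    -- Roots turn the equivalence closure `SameChain` into an equality of letters.
    IsRoot : Fin n → Fin n → Set ℓ
    IsRoot m i = Star (flip Arc) i m × (∀ a → ¬ Arc a m)

    root-exists : ∀ i → ∃[ m ] IsRoot m i
    root-exists = pos-rec _ λ i rec → step i rec (any? λ a → Arc? a i)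
      where
      step : ∀ i → (∀ j → pos j Fin.< pos i → ∃[ m ] IsRoot m j) → Dec (∃[ a ] Arc a i) → ∃[ m ] IsRoot m i
      step i rec (yes (a , ai)) = let m , path , top = rec a (I⇒pos< (proj₁ ai)) in m , ai ◅ path , top
      step i rec (no none) = i , nil , λ a ai → none (a , ai)

    root-unique : ∀ {m m′ i} → IsRoot m i → IsRoot m′ i → m ≡ m′
    root-unique (p , top) (q , top′) = go p q top top′
      where
      go : ∀ {m m′ i} → Star (flip Arc) i m → Star (flip Arc) i m′ →
           (∀ a → ¬ Arc a m) → (∀ a → ¬ Arc a m′) → m ≡ m′
      go nil     nil     top top′ = refl
      go nil     (a ◅ _) top top′ = contradiction a (top _)
      go (a ◅ _) nil     top top′ = contradiction a (top′ _)
      go (a ◅ p) (b ◅ q) top top′ with refl ← Arc-injˡ a b = go p q top top′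

    root : Fin n → Fin n
    root i = proj₁ (root-exists i)

    root-isRoot : ∀ i → IsRoot (root i) i
    root-isRoot i = proj₂ (root-exists i)

    Arc⇒root≡ : ∀ {a b} → Arc a b → root a ≡ root b
    Arc⇒root≡ {a} {b} ab = root-unique (ab ◅ proj₁ (root-isRoot a) , proj₂ (root-isRoot a)) (root-isRoot b)

    SameChain⇒root≡ : ∀ {i k} → SameChain i k → root i ≡ root k
    SameChain⇒root≡ nil = refl
    SameChain⇒root≡ (fwd ab ◅ p) = trans (Arc⇒root≡ ab) (SameChain⇒root≡ p)
    SameChain⇒root≡ (bwd ab ◅ p) = trans (sym (Arc⇒root≡ ab)) (SameChain⇒root≡ p)

    descent : ∀ {i m} → Star (flip Arc) i m → SameChain i m × pos m Fin.≤ pos i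
    descent nil = nil , ℕₚ.≤-refl
    descent (a ◅ p) = let s , le = descent p in bwd a ◅ s , ℕₚ.≤-trans le (ℕₚ.<⇒≤ (I⇒pos< (proj₁ a)))

    root-leftmost : ∀ i → IsLeftmost (root i) i
    root-leftmost i = proj₁ (descent (proj₁ (root-isRoot i))) , λ k s →
      subst (λ m → pos m Fin.≤ pos k) (sym (SameChain⇒root≡ s)) (proj₂ (descent (proj₁ (root-isRoot k))))

    root-starts : ChainStarts (pos ∘ root)
    root-starts i = root i , root-leftmost i , refl

    starts-unique : ∀ {f} → ChainStarts f → ∀ i → f i ≡ pos (root i)
    starts-unique starts i =
      let m , (s , left) , eq = starts i
          s′ , left′ = root-leftmost i
      in trans eq (Finₚ.≤-antisym (left _ s′) (left′ _ s))

    ascent : ∀ {a c} → Star Arc a c → a Fin.≤ c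
    ascent nil = ℕₚ.≤-refl
    ascent (a ◅ p) = ℕₚ.≤-trans (ℕₚ.<⇒≤ (I⇒< (proj₁ a))) (ascent p)

    from-root : ∀ i → Star Arc (root i) i
    from-root i = reverse id (proj₁ (root-isRoot i))

    -- Arcs out of a letter are unique, so of two paths from a common letter one continues the
    -- other.
    linear : ∀ {m a c} → Star Arc m a → Star Arc m c → Star Arc a c ⊎ Star Arc c a
    linear nil q = inj₁ q
    linear (a ◅ p) nil = inj₂ (a ◅ p)
    linear (a ◅ p) (b ◅ q) with refl ← Arc-injʳ a b = linear p q

    module _ {f : Fin n → Fin n} (starts : ChainStarts f) where

      private
        f≡ : ∀ i → f i ≡ pos (root i)
        f≡ = starts-unique starts

      f≡⇒root≡ : ∀ {a b} → f a ≡ f b → root a ≡ root b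
      f≡⇒root≡ {a} {b} eq = pos-injective (trans (sym (f≡ a)) (trans eq (f≡ b)))

      root≡⇒f≡ : ∀ {a b} → root a ≡ root b → f a ≡ f b
      root≡⇒f≡ {a} {b} eq = trans (f≡ a) (trans (cong pos eq) (sym (f≡ b)))

      comparable : ∀ {a c} → f a ≡ f c → Star Arc a c ⊎ Star Arc c a
      comparable {a} {c} eq = linear (from-root a) (subst (λ m → Star Arc m c) (sym (f≡⇒root≡ eq)) (from-root c))

      -- Letters with equal `f` have the same root and thus lie on one path of arcs, along which
      -- values increase. A letter of the fibre is therefore reached before a or after b.
      Arc⇒Next : ∀ {a b} → Arc a b → Next f a b
      Arc⇒Next {a} {b} ab = root≡⇒f≡ (Arc⇒root≡ ab) , I⇒< (proj₁ ab) , λ c eq c<b →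
        largest c c<b (comparable (trans (root≡⇒f≡ (Arc⇒root≡ ab)) (sym eq)))
        where
        largest : ∀ c → c Fin.< b → Star Arc a c ⊎ Star Arc c a → c Fin.≤ a
        largest c c<b (inj₁ nil) = ℕₚ.≤-refl
        largest c c<b (inj₁ (ab′ ◅ p)) with refl ← Arc-injʳ ab ab′ = contradiction (ascent p) (ℕₚ.<⇒≱ c<b)
        largest c c<b (inj₂ p) = ascent p

      -- The path from a to b begins with an arc to some letter of the fibre, and no such letter
      -- lies strictly between a and b.
      Next⇒Arc : ∀ {a b} → Next f a b → Arc a b
      Next⇒Arc {a} {b} (eq , a<b , max) = step (comparable eq)
        where
        step : Star Arc a b ⊎ Star Arc b a → Arc a b
        step (inj₂ p) = contradiction (ascent p) (ℕₚ.<⇒≱ a<b)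
        step (inj₁ nil) = contradiction a<b (ℕₚ.<-irrefl refl)
        step (inj₁ (_◅_ {j = c} ac p)) with ℕₚ.m≤n⇒m<n∨m≡n (ascent p)
        ... | inj₂ c≡b = subst (Arc a) (toℕ-injective c≡b) ac
        ... | inj₁ c<b = contradiction (max c (trans (sym (root≡⇒f≡ (Arc⇒root≡ ac))) eq) c<b)
                                       (ℕₚ.<⇒≱ (I⇒< (proj₁ ac)))

      layout : Layout f w
      layout .Layout.origin i with any? (λ a → Arc? a i)
      ... | yes (a , ai) = inj₂ (a , Arc⇒Next ai , I⇒pos< (proj₁ ai))
      ... | no none = inj₁ (trans (f≡ i) (cong pos root≡i) , λ k eq →
              subst (Fin._≤ k) (trans (f≡⇒root≡ eq) root≡i) (ascent (from-root k)))
        where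
        root≡i : root i ≡ i
        root≡i = root-unique (root-isRoot i) (nil , λ a ai → none (a , ai))
      layout .Layout.nonnesting ab cd ac db =
        sym (cong proj₁ (Arc-minimal (Next⇒Arc ab) (proj₁ (Next⇒Arc cd)) ac db))

      -- Injectivity uses this to recover the initial arcs from `f` and the word.
      I⇔Contains-Next : ∀ {i l} →
        (I i l → i Fin.< l × ∃[ j ] ∃[ k ] Next f j k × pos i Fin.≤ pos j × pos k Fin.≤ pos l) ×
        (i Fin.< l × (∃[ j ] ∃[ k ] Next f j k × pos i Fin.≤ pos j × pos k Fin.≤ pos l) → I i l)
      I⇔Contains-Next =
        (λ il → let j , k , jk , ij , kl = Contains-Arc il in I⇒< il , j , k , Arc⇒Next jk , ij , kl) ,
        (λ { (i<l , j , k , jk , ij , kl) → I-up i<l (j , k , proj₁ (Next⇒Arc jk) , ij , kl) })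

      -- The letters at the first `suc (toℕ j)` positions supply the elements, because a chain
      -- starts no later than any of its letters stands.
      parking : IsParking f
      parking j = injection⇒≤length (λ i → f i Finₚ.≤? j) g g-inj λ p →
        ℕₚ.≤-trans (Layout.f≤pos layout (g p))
          (ℕₚ.≤-trans (ℕₚ.≤-reflexive (trans (cong toℕ (pos-word (inj p))) (Finₚ.toℕ-inject≤ p j<n)))
            (ℕₚ.≤-pred (toℕ<n p)))
        where
        j<n : suc (toℕ j) ≤ n
        j<n = toℕ<n j
        inj : Fin (suc (toℕ j)) → Fin n
        inj p = Fin.inject≤ p j<n
        g : Fin (suc (toℕ j)) → Fin n
        g = word ∘ inj
        g-inj : Injective _≡_ _≡_ g
        g-inj {p} {q} eq = Finₚ.inject≤-injective j<n j<n p q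
          (trans (sym (pos-word (inj p))) (trans (cong pos eq) (pos-word (inj q))))

  module _ {f : Fin n → Fin n} (L : Layout f w)
           (I⇒Next : ∀ {i l} → I i l → ∃[ j ] ∃[ k ] Next f j k × pos i Fin.≤ pos j × pos k Fin.≤ pos l)
           (Next⇒I : ∀ {i l} → Next f i l → I i l) where

    open Layout L

    private
      -- An initial arc inside i, l contains in turn a pair of consecutive fibre elements.
      -- Nonnesting makes that pair equal to i, l, and the arc caught between them as well.
      Next⇒minimal : ∀ {i l} → Next f i l → ¬ ContainsAnother i l
      Next⇒minimal {i} {l} il (j , k , jk , neq , ij , kl) with I⇒Next jk
      ... | a , b , ab , ja , bk = neq (cong₂ _,_ j≡i k≡l)
        where
        i≡a : i ≡ a
        i≡a = nonnesting il ab (ℕₚ.≤-trans ij ja) (ℕₚ.≤-trans bk kl)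
        l≡b : l ≡ b
        l≡b = Next-injʳ f il (subst (λ z → Next f z b) (sym i≡a) ab)
        j≡i : j ≡ i
        j≡i = pos-injective (Finₚ.≤-antisym (subst (λ z → pos j Fin.≤ pos z) (sym i≡a) ja) ij)
        k≡l : k ≡ l
        k≡l = pos-injective (Finₚ.≤-antisym kl (subst (λ z → pos z Fin.≤ pos k) (sym l≡b) bk))

      Next⇒minimal-Arc : ∀ {i l} → Next f i l → Arc i l
      Next⇒minimal-Arc il = Next⇒I il , Next⇒minimal il

      Arc⇒f≡ : ∀ {i l} → Arc i l → f i ≡ f l
      Arc⇒f≡ {i} {l} (il , none) with I⇒Next il
      ... | j , k , jk , ij , kl with ≡-dec Finₚ._≟_ Finₚ._≟_ (j , k) (i , l)
      ... | yes refl = proj₁ jk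
      ... | no neq = contradiction (j , k , Next⇒I jk , neq , ij , kl) none

      SameChain⇒f≡ : ∀ {i k} → SameChain i k → f i ≡ f k
      SameChain⇒f≡ nil = refl
      SameChain⇒f≡ (fwd ab ◅ p) = trans (Arc⇒f≡ ab) (SameChain⇒f≡ p)
      SameChain⇒f≡ (bwd ab ◅ p) = trans (sym (Arc⇒f≡ ab)) (SameChain⇒f≡ p)

      start : ∀ i → ∃[ m ] SameChain i m × f i ≡ pos m
      start = pos-rec _ λ i rec → step i rec (origin i)
        where
        step : ∀ i → (∀ j → pos j Fin.< pos i → ∃[ m ] SameChain j m × f j ≡ pos m) → _ →
               ∃[ m ] SameChain i m × f i ≡ pos m
        step i rec (inj₁ (e , _)) = i , nil , e
        step i rec (inj₂ (a , nx , lt)) =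
          let m , s , e = rec a lt in m , bwd (Next⇒minimal-Arc nx) ◅ s , trans (sym (proj₁ nx)) e

    -- `f` is constant on chains and never exceeds the position, so the letter of the chain at
    -- position `f i` is leftmost.
    layout⇒starts : ChainStarts f
    layout⇒starts i =
      let m , s , e = start i
      in m , (s , λ k s′ → subst (Fin._≤ pos k) (trans (sym (SameChain⇒f≡ s′)) e) (f≤pos k)) , e

-- The layout of a parking function

injective⇒surjective : (g : Fin n → Fin n) → Injective _≡_ _≡_ g → ∀ p → ∃[ i ] g i ≡ p
injective⇒surjective {zero}  g g-inj ()
injective⇒surjective {suc n} g g-inj p with any? (λ i → g i Finₚ.≟ p)
... | yes found = found
... | no none = contradiction (Finₚ.injective⇒≤ {f = h} h-inj) (ℕₚ.<-irrefl refl)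
  where
  p≢g : ∀ i → p ≢ g i
  p≢g i eq = none (i , sym eq)
  h : Fin (suc n) → Fin n
  h i = Fin.punchOut (p≢g i)
  h-inj : Injective _≡_ _≡_ h
  h-inj {i} {j} eq = g-inj (Finₚ.punchOut-injective (p≢g i) (p≢g j) eq)

injective⇒permutation : (g : Fin n → Fin n) → Injective _≡_ _≡_ g → ∃[ w ] ∀ i → Positions.pos w i ≡ g i
injective⇒permutation g g-inj = Perm.permutation (proj₁ ∘ inv) g
  (λ i → g-inj (proj₂ (inv (g i))))
  (λ p → proj₂ (inv p)) , λ i → refl
  where inv = injective⇒surjective g g-inj

Unique⇒lookup-injective : ∀ {a} {A : Set a} {xs : List A} → Unique xs → Injective _≡_ _≡_ (lookup xs)
Unique⇒lookup-injective {xs = x ∷ xs} (px ∷ u) {Fin.zero}  {Fin.zero}  eq = refl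
Unique⇒lookup-injective {xs = x ∷ xs} (px ∷ u) {Fin.zero}  {Fin.suc j} eq =
  contradiction eq (All.lookup px (∈-lookup j))
Unique⇒lookup-injective {xs = x ∷ xs} (px ∷ u) {Fin.suc i} {Fin.zero}  eq =
  contradiction (sym eq) (All.lookup px (∈-lookup i))
Unique⇒lookup-injective {xs = x ∷ xs} (px ∷ u) {Fin.suc i} {Fin.suc j} eq =
  cong Fin.suc (Unique⇒lookup-injective u eq)

length≤injection : ∀ {q} {P : U.Pred (Fin n) ℓ} (P? : U.Decidable P) (T : Fin n → ℕ) →
                   (∀ i → P i → T i ℕ.< q) → (∀ {i j} → T i ≡ T j → T i ℕ.< q → i ≡ j) →
                   length (filter P? (allFin n)) ≤ q
length≤injection {n = n} {q = q} P? T T<q T-inj = Finₚ.injective⇒≤ {f = g} λ {k} {l} eq →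
  Unique⇒lookup-injective (filter⁺ P? (allFin⁺ n))
    (T-inj (Finₚ.fromℕ<-injective _ _ (below k) (below l) eq) (below k))
  where
  xs = filter P? (allFin n)
  below : ∀ k → T (lookup xs k) ℕ.< q
  below k = T<q _ (proj₂ (∈-filter⁻ P? {xs = allFin n} (∈-lookup k)))
  g : Fin (length xs) → Fin q
  g k = fromℕ< (below k)

module Construction {n} (f : Fin n → Fin n) where

  Start : Fin n → Set
  Start i = ∀ k → f k ≡ f i → i Fin.≤ k

  -- T i is the position of i, or n as long as i has not been placed.
  record Partial (q : ℕ) : Set where
    field
      T          : Fin n → ℕ
      covered    : ∀ p → p ℕ.< q → ∃[ i ] T i ≡ p
      injective  : ∀ {i j} → T i ≡ T j → T i ℕ.< q → i ≡ j
      late       : ∀ i → q ≤ T i → T i ≡ n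
      origin     : ∀ i → T i ℕ.< q → (toℕ (f i) ≡ T i × Start i) ⊎ (∃[ a ] Next f a i × T a ℕ.< T i)
      opened     : ∀ i → toℕ (f i) ℕ.< q → ∃[ m ] f m ≡ f i × T m ℕ.< q × Start m
      -- Only the inner right end d has to be placed. A missing b has the value n and counts as far
      -- to the right, so the condition also forbids serving c before an earlier letter whose
      -- successor is missing.
      nonnesting : ∀ {a b c d} → Next f a b → Next f c d → T a ≤ T c → T d ℕ.< q → T d ≤ T b → a ≡ c

    Next⇒T< : ∀ {a b} → Next f a b → T b ℕ.< q → T a ℕ.< T b
    Next⇒T< {a} {b} nx lt with origin b lt
    ... | inj₁ (_ , min) = contradiction (min a (proj₁ nx)) (ℕₚ.<⇒≱ (proj₁ (proj₂ nx)))
    ... | inj₂ (a′ , nx′ , lt′) = subst (λ z → T z ℕ.< T b) (Next-injˡ f nx′ nx) lt′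

    f≤T : ∀ i → T i ℕ.< q → toℕ (f i) ≤ T i
    f≤T i lt = go i lt (<-wellFounded (T i))
      where
      go : ∀ i → T i ℕ.< q → Acc ℕ._<_ (T i) → toℕ (f i) ≤ T i
      go i lt (acc rs) with origin i lt
      ... | inj₁ (e , _) = ℕₚ.≤-reflexive e
      ... | inj₂ (a , nx , lt′) = subst (λ z → toℕ z ≤ T i) (proj₁ nx)
              (ℕₚ.≤-trans (go a (ℕₚ.<-trans lt′ lt) (rs lt′)) (ℕₚ.<⇒≤ lt′))

  open Partial

  empty : Partial 0
  empty = record
    { T = λ _ → n ; covered = λ _ () ; injective = λ _ () ; late = λ _ _ → refl
    ; origin = λ _ () ; opened = λ _ () ; nonnesting = λ _ _ _ () }

  -- Place d at position q.  The second alternative for d is the queue discipline: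
  -- no letter with a missing successor stands to the left of the predecessor of d.
  module Extension {q} (q<n : q ℕ.< n) (π : Partial q) (d : Fin n) (fresh : q ≤ T π d)
    (source : (toℕ (f d) ≡ q × Start d) ⊎
              (∃[ c ] Next f c d × T π c ℕ.< q × (∀ a b → Next f a b → T π a ℕ.< q → q ≤ T π b → T π c ≤ T π a)))
    (opens : ∀ i → toℕ (f i) ≡ q → f d ≡ f i × Start d) where

    T′ : Fin n → ℕ
    T′ i with i Finₚ.≟ d
    ... | yes _ = q
    ... | no _ = T π i

    new : T′ d ≡ q
    new with d Finₚ.≟ d
    ... | yes _ = refl
    ... | no d≢d = contradiction refl d≢d

    old : ∀ {i} → i ≢ d → T′ i ≡ T π i
    old {i} i≢d with i Finₚ.≟ d
    ... | yes i≡d = contradiction i≡d i≢d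
    ... | no _ = refl

    placed : ∀ {i} → T π i ℕ.< q → T′ i ≡ T π i
    placed lt = old λ { refl → ℕₚ.<⇒≱ lt fresh }

    cases : ∀ i → T′ i ℕ.< suc q → (T π i ℕ.< q × T′ i ≡ T π i) ⊎ i ≡ d
    cases i lt with i Finₚ.≟ d
    ... | yes i≡d = inj₂ i≡d
    ... | no _ with T π i ℕₚ.<? q
    ...   | yes lt′ = inj₁ (lt′ , refl)
    -- A letter not yet placed has the value n, and q < n keeps it from counting as placed at stage
    -- `suc q`.
    ...   | no ge = contradiction (ℕₚ.≤-trans q<n (ℕₚ.≤-reflexive (sym (late π i (ℕₚ.≮⇒≥ ge))))) (ℕₚ.<⇒≱ lt)

    unplaced : ∀ i → q ≤ T′ i → q ≤ T π i
    unplaced i le = ℕₚ.≮⇒≥ λ lt → ℕₚ.<⇒≱ lt (subst (q ≤_) (placed lt) le)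

    d-origin : (toℕ (f d) ≡ T′ d × Start d) ⊎ (∃[ a ] Next f a d × T′ a ℕ.< T′ d)
    d-origin = Sum.map
      (λ (e , start) → trans e (sym new) , start)
      (λ (c , nx , c<q , _) → c , nx , subst₂ ℕ._<_ (sym (placed c<q)) (sym new) c<q)
      source

    d-source : ∀ {c} → Next f c d →
               T π c ℕ.< q × (∀ a b → Next f a b → T π a ℕ.< q → q ≤ T π b → T π c ≤ T π a)
    d-source {c} nx = Sum.[
      (λ (_ , start) → contradiction (start c (proj₁ nx)) (ℕₚ.<⇒≱ (proj₁ (proj₂ nx)))) ,
      (λ (c′ , nx′ , rest) → subst
        (λ z → T π z ℕ.< q × (∀ a b → Next f a b → T π a ℕ.< q → q ≤ T π b → T π z ≤ T π a))
        (Next-injˡ f nx′ nx) rest) ]′ source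

    extension : Partial (suc q)
    extension .T = T′
    extension .covered p p<1+q with ℕₚ.m<1+n⇒m<n∨m≡n p<1+q
    ... | inj₂ refl = d , new
    ... | inj₁ p<q with covered π p p<q
    ...   | i , refl = i , placed p<q
    extension .injective {i} {j} eq lt with cases i lt | cases j (subst (ℕ._< suc q) eq lt)
    ... | inj₁ (lt′ , e) | inj₁ (_ , e′) = injective π (trans (sym e) (trans eq e′)) lt′
    ... | inj₁ (lt′ , e) | inj₂ refl = contradiction (trans (sym e) (trans eq new)) (ℕₚ.<⇒≢ lt′)
    ... | inj₂ refl | inj₁ (lt′ , e) = contradiction (trans (sym e) (trans (sym eq) new)) (ℕₚ.<⇒≢ lt′)
    ... | inj₂ refl | inj₂ refl = refl
    extension .late i lt = trans (old i≢d) (late π i (unplaced i (ℕₚ.<⇒≤ lt)))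
      where
      i≢d : i ≢ d
      i≢d refl = ℕₚ.<-irrefl (sym new) lt
    extension .origin i lt with cases i lt
    ... | inj₁ (lt′ , e) with origin π i lt′
    ...   | inj₁ (e′ , start) = inj₁ (trans e′ (sym e) , start)
    ...   | inj₂ (a , nx , a<i) = inj₂ (a , nx , subst₂ ℕ._<_ (sym (placed (ℕₚ.<-trans a<i lt′))) (sym e) a<i)
    extension .origin i lt | inj₂ refl = d-origin
    extension .opened i lt with ℕₚ.m<1+n⇒m<n∨m≡n lt
    ... | inj₁ lt′ = let m , e , m<q , start = opened π i lt′
                     in m , e , subst (ℕ._< suc q) (sym (placed m<q)) (ℕₚ.m<n⇒m<1+n m<q) , start
    ... | inj₂ e = let e′ , start = opens i e in d , e′ , ℕₚ.≤-reflexive (cong suc new) , start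
    extension .nonnesting {a} {b} {c} {e} ab ce a≤c e<1+q e≤b with cases e e<1+q
    ... | inj₁ (e<q , eq) = nonnesting π ab ce (subst₂ _≤_ Ta≡ Tc≡ a≤c) e<q Te≤Tb
      where
      c<q : T π c ℕ.< q
      c<q = ℕₚ.<-trans (Next⇒T< π ce e<q) e<q
      Tc≡ : T′ c ≡ T π c
      Tc≡ = placed c<q
      a<q : T π a ℕ.< q
      a<q = ℕₚ.≰⇒> λ le → ℕₚ.<⇒≱ c<q (ℕₚ.≤-trans (late-≤ a le) (ℕₚ.≤-trans a≤c (ℕₚ.≤-reflexive Tc≡)))
        where
        late-≤ : ∀ a → q ≤ T π a → q ≤ T′ a
        late-≤ a le with a Finₚ.≟ d
        ... | yes _ = ℕₚ.≤-refl
        ... | no _ = le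
      Ta≡ : T′ a ≡ T π a
      Ta≡ = placed a<q
      Te≤Tb : T π e ≤ T π b
      Te≤Tb with T π b ℕₚ.<? q
      ... | yes lt = subst₂ _≤_ eq (placed lt) e≤b
      ... | no ge = ℕₚ.≤-trans (ℕₚ.<⇒≤ e<q) (ℕₚ.≮⇒≥ ge)
    -- The new arc is the inner one. If b differs from d, then b is still missing while a is placed,
    -- so the queue discipline bounds the position of c by that of a.
    ... | inj₂ refl with b Finₚ.≟ d
    ...   | yes refl = Next-injˡ f ab ce
    ...   | no _ = injective π (ℕₚ.≤-antisym Ta≤Tc (earliest a b ab a<q q≤Tb)) a<q
      where
      c′<q : T π c ℕ.< q
      c′<q = proj₁ (d-source ce)
      earliest : ∀ a b → Next f a b → T π a ℕ.< q → q ≤ T π b → T π c ≤ T π a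
      earliest = proj₂ (d-source ce)
      T′a<q : T′ a ℕ.< q
      T′a<q = ℕₚ.≤-<-trans a≤c (subst (ℕ._< q) (sym (placed c′<q)) c′<q)
      a<q : T π a ℕ.< q
      a<q with cases a (ℕₚ.m<n⇒m<1+n T′a<q)
      ... | inj₁ (lt , _) = lt
      ... | inj₂ refl = contradiction new (ℕₚ.<⇒≢ T′a<q)
      Ta≤Tc : T π a ≤ T π c
      Ta≤Tc = subst₂ _≤_ (placed a<q) (placed c′<q) a≤c
      q≤Tb : q ≤ T π b
      q≤Tb = subst (_≤ T π b) new e≤b

  module _ (parking : IsParking f) where

    extend : ∀ {q} → q ℕ.< n → Partial q → Partial (suc q)
    extend {q} q<n π with any? (λ i → toℕ (f i) ℕₚ.≟ q)
    ... | yes ex =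
      let d , fd≡q , min = minimise (λ i → toℕ (f i) ℕₚ.≟ q) toℕ ex
          start : Start d
          start k e = min k (trans (cong toℕ e) fd≡q)
      in Extension.extension q<n π d
           -- A placed letter stands no earlier than its value of `f`, which is q here.
           (ℕₚ.≮⇒≥ λ lt → ℕₚ.<⇒≱ lt (subst (_≤ T π d) fd≡q (f≤T π d lt)))
           (inj₁ (fd≡q , start))
           (λ i e → toℕ-injective (trans fd≡q (sym e)) , start)
    ... | no none = front (minimise pending? (T π) some-pending)
      where
      Pending : Fin n → Set
      Pending c = T π c ℕ.< q × ∃[ d ] Next f c d × q ≤ T π d
      pending? : U.Decidable Pending
      pending? c = (T π c ℕₚ.<? q) ×-dec any? λ d → Next? f c d ×-dec (q ℕₚ.≤? T π d)
      -- The parking condition gives at least `suc q` letters with `f i` at most q, too many for the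
      -- q positions filled so far.
      waiting : ∃[ i ] toℕ (f i) ≤ q × q ≤ T π i
      waiting with any? (λ i → (toℕ (f i) ℕₚ.≤? q) ×-dec (q ℕₚ.≤? T π i))
      ... | yes found = found
      ... | no all-placed = contradiction
              (length≤injection (λ i → f i Finₚ.≤? fromℕ< q<n) (T π)
                (λ i le → ℕₚ.≰⇒> λ q≤T → all-placed (i , subst (toℕ (f i) ≤_) (Finₚ.toℕ-fromℕ< q<n) le , q≤T))
                (injective π))
              (ℕₚ.<⇒≱ (ℕₚ.≤-<-trans (ℕₚ.≤-reflexive (sym (Finₚ.toℕ-fromℕ< q<n))) (parking (fromℕ< q<n))))
      -- The least letter of the fibre is already placed, so going down the fibre from a missing
      -- letter must cross from missing to placed.
      descend : ∀ i → toℕ (f i) ℕ.< q → q ≤ T π i → Acc ℕ._<_ (toℕ i) → ∃ Pending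
      descend i fi<q q≤Ti (acc rs) with opened π i fi<q
      ... | m , e , m<q , start with predecessor f e (ℕₚ.≤∧≢⇒< (start i (sym e)) λ eq →
              ℕₚ.<⇒≱ m<q (subst (λ z → q ≤ T π z) (sym (toℕ-injective eq)) q≤Ti))
      ...   | c , nx with T π c ℕₚ.<? q
      ...     | yes c<q = c , c<q , i , nx , q≤Ti
      ...     | no ge = descend c
                (subst (λ z → toℕ z ℕ.< q) (sym (proj₁ nx)) fi<q) (ℕₚ.≮⇒≥ ge) (rs (proj₁ (proj₂ nx)))
      some-pending : ∃ Pending
      some-pending = let i , fi≤q , q≤Ti = waiting
                     in descend i (ℕₚ.≤∧≢⇒< fi≤q λ e → none (i , e)) q≤Ti (<-wellFounded (toℕ i))
      front : (∃[ c ] Pending c × (∀ a → Pending a → T π c ≤ T π a)) → Partial (suc q)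
      front (c , (c<q , d , nx , q≤Td) , earliest) = Extension.extension q<n π d q≤Td
        (inj₂ (c , nx , c<q , λ a b ab a<q q≤Tb → earliest a (a<q , b , ab , q≤Tb)))
        (λ i e → contradiction (i , e) none)

    build : ∀ q → q ≤ n → Partial q
    build zero    _   = empty
    build (suc q) q<n = extend q<n (build q (ℕₚ.<⇒≤ q<n))

    layout-exists : ∃[ w ] Layout f w
    layout-exists = w , record
      { origin = λ i → origin′ i (origin π i (T<n i))
      ; nonnesting = λ {a} {b} {c} {d} ab cd a≤c d≤b →
          nonnesting π ab cd (subst₂ _≤_ (pos≡ a) (pos≡ c) a≤c) (T<n d) (subst₂ _≤_ (pos≡ d) (pos≡ b) d≤b) }
      where
      π : Partial n
      π = build n ℕₚ.≤-refl
      at : Fin n → Fin n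
      at p = proj₁ (covered π (toℕ p) (toℕ<n p))
      T-at : ∀ p → T π (at p) ≡ toℕ p
      T-at p = proj₂ (covered π (toℕ p) (toℕ<n p))
      at-inj : Injective _≡_ _≡_ at
      at-inj {p} {q} eq = toℕ-injective (trans (sym (T-at p)) (trans (cong (T π) eq) (T-at q)))
      -- The n positions hold distinct letters, hence all letters, and none is left with the default
      -- value n.
      T<n : ∀ i → T π i ℕ.< n
      T<n i = let p , e = injective⇒surjective at at-inj i
              in subst (ℕ._< n) (trans (sym (T-at p)) (cong (T π) e)) (toℕ<n p)
      g : Fin n → Fin n
      g i = fromℕ< (T<n i)
      perm : ∃[ w ] ∀ i → Positions.pos w i ≡ g i
      perm = injective⇒permutation g λ {i} {j} eq → injective π (Finₚ.fromℕ<-injective _ _ (T<n i) (T<n j) eq) (T<n i)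
      w : Permutation′ n
      w = proj₁ perm
      open Positions w
      pos≡ : ∀ i → toℕ (pos i) ≡ T π i
      pos≡ i = trans (cong toℕ (proj₂ perm i)) (Finₚ.toℕ-fromℕ< (T<n i))
      origin′ : ∀ i → (toℕ (f i) ≡ T π i × Start i) ⊎ (∃[ a ] Next f a i × T π a ℕ.< T π i) →
                (f i ≡ pos i × Start i) ⊎ (∃[ a ] Next f a i × pos a Fin.< pos i)
      origin′ i (inj₁ (e , start)) = inj₁ (toℕ-injective (trans e (sym (pos≡ i))) , start)
      origin′ i (inj₂ (a , nx , lt)) = inj₂ (a , nx , subst₂ ℕ._<_ (sym (pos≡ a)) (sym (pos≡ i)) lt)

-- Realising a set of arcs by rational coordinates

module Semiorder (C : Rel ℕ 0ℓ) (C? : Decidable C)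
                 (C-up : ∀ {p p′ q q′} → p′ ≤ p → q ≤ q′ → C p q → C p′ q′) where

  open ℚ-Arithmetic
  open import Data.Rational.Base using (_+_; _-_)
  open +-*-Solver using (solve; _:=_; _:+_; _:-_; con)

  Spaced : (ℕ → ℚ) → Rel ℕ 0ℓ
  Spaced y p q = y q ℚ.< y p × (C p q → 1ℚ ℚ.< y p - y q) × (¬ C p q → y p - y q ℚ.< 1ℚ)

  minimum : ∀ N (u : ℕ → ℚ) → ∃[ m ] m ≤ N × (∀ q → q ≤ N → u m ℚ.≤ u q)
  minimum zero    u = 0 , z≤n , λ { _ z≤n → ℚₚ.≤-refl }
  minimum (suc N) u = step (minimum N u) (ℚₚ.≤-total (u (suc N)) (u (proj₁ (minimum N u))))
    where
    step : (r : ∃[ m ] m ≤ N × (∀ q → q ≤ N → u m ℚ.≤ u q)) →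
           u (suc N) ℚ.≤ u (proj₁ r) ⊎ u (proj₁ r) ℚ.≤ u (suc N) →
           ∃[ m ] m ≤ suc N × (∀ q → q ≤ suc N → u m ℚ.≤ u q)
    step (m , m≤N , min) (inj₁ le) = suc N , ℕₚ.≤-refl , λ q q≤1+N →
      Sum.[ (λ q<1+N → ℚₚ.≤-trans le (min q (ℕₚ.≤-pred q<1+N))) , (λ { refl → ℚₚ.≤-refl }) ]′ (ℕₚ.m≤n⇒m<n∨m≡n q≤1+N)
    step (m , m≤N , min) (inj₂ ge) = m , ℕₚ.m≤n⇒m≤1+n m≤N , λ q q≤1+N →
      Sum.[ (λ q<1+N → min q (ℕₚ.≤-pred q<1+N)) , (λ { refl → ge }) ]′ (ℕₚ.m≤n⇒m<n∨m≡n q≤1+N)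

  -- Finitely many lower bounds below u leave room for a rational strictly in between, by density of
  -- ℚ one bound at a time.
  squeeze : ∀ N (P : U.Pred ℕ 0ℓ) (P? : U.Decidable P) (l : ℕ → ℚ) u →
            (∀ p → p ℕ.< N → P p → l p ℚ.< u) →
            ∃[ v ] v ℚ.< u × (∀ p → p ℕ.< N → P p → l p ℚ.< v)
  squeeze zero P P? l u h = u - 1ℚ , u-1<u , λ _ ()
    where
    u-1<u : u - 1ℚ ℚ.< u
    u-1<u = shift-< (δ-pos 0) (solve 1 (λ u → (u :- con 1ℚ) :+ con 1ℚ := u :+ con 0ℚ) refl u)
  squeeze (suc N) P P? l u h = step (squeeze N P P? l u λ p p<N → h p (ℕₚ.m<n⇒m<1+n p<N)) (P? N)
    where
    Goal : Set
    Goal = ∃[ v ] v ℚ.< u × (∀ p → p ℕ.< suc N → P p → l p ℚ.< v)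
    raise : ∀ {v} → (∀ p → p ℕ.< N → P p → l p ℚ.< v) → (v′ : ∃[ v′ ] (v ℚ.⊔ l N) ℚ.< v′ × v′ ℚ.< u) → Goal
    raise {v} lower (v′ , below , v′<u) = v′ , v′<u , λ p p<1+N Pp →
      Sum.[ (λ p<N → ℚₚ.<-trans (lower p p<N Pp) (ℚₚ.≤-<-trans (ℚₚ.p≤p⊔q v (l N)) below))
          , (λ { refl → ℚₚ.≤-<-trans (ℚₚ.p≤q⊔p v (l N)) below }) ]′ (ℕₚ.m<1+n⇒m<n∨m≡n p<1+N)
    step : (∃[ v ] v ℚ.< u × (∀ p → p ℕ.< N → P p → l p ℚ.< v)) → Dec (P N) → Goal
    step (v , v<u , lower) (no ¬PN) = v , v<u , λ p p<1+N Pp →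
      Sum.[ (λ p<N → lower p p<N Pp) , (λ { refl → contradiction Pp ¬PN }) ]′ (ℕₚ.m<1+n⇒m<n∨m≡n p<1+N)
    step (v , v<u , lower) (yes PN) = raise lower (ℚₚ.<-dense
      (Sum.[ (λ e → subst (ℚ._< u) (sym e) v<u)
           , (λ e → subst (ℚ._< u) (sym e) (h N ℕₚ.≤-refl PN)) ]′ (ℚₚ.⊔-sel v (l N))))

  module _ (N : ℕ) (y : ℕ → ℚ) (spaced : ∀ p q → p ℕ.< q → q ℕ.≤ N → Spaced y p q) where

    private
      lower : ℕ → ℚ
      lower p = y p - 1ℚ

      upper : ∀ q → Dec (C q (suc N)) → ℚ
      upper q (yes _) = y q - 1ℚ
      upper q (no _)  = y q

      y-1<y : ∀ q → y q - 1ℚ ℚ.< y q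
      y-1<y q = shift-< (δ-pos 0) (solve 1 (λ u → (u :- con 1ℚ) :+ con 1ℚ := u :+ con 0ℚ) refl (y q))

      -- The bounds on the new value are compatible because `C` is closed under enlarging intervals.
      -- If q but not p must be far from the new point, then q precedes p. If neither must be, p and
      -- q are themselves less than 1 apart whenever p precedes q.
      lower<upper : ∀ p q → p ℕ.≤ N → q ℕ.≤ N → ¬ C p (suc N) → (c : Dec (C q (suc N))) → lower p ℚ.< upper q c
      lower<upper p q p≤N q≤N ¬c (yes c) =
        ℚₚ.+-monoˡ-< (ℚ.- 1ℚ) (proj₁ (spaced q p (ℕₚ.≰⇒> λ p≤q → ¬c (C-up p≤q ℕₚ.≤-refl c)) p≤N))
      lower<upper p q p≤N q≤N ¬c (no _) = compare (ℕₚ.<-cmp p q)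
        where
        compare : Tri (p ℕ.< q) (p ≡ q) (q ℕ.< p) → lower p ℚ.< y q
        compare (tri< p<q _ _) =
          shift-< (proj₂ (proj₂ (spaced p q p<q q≤N)) λ c → ¬c (C-up ℕₚ.≤-refl (ℕₚ.m≤n⇒m≤1+n q≤N) c))
            (solve 2 (λ a b → (a :- con 1ℚ) :+ con 1ℚ := b :+ (a :- b)) refl (y p) (y q))
        compare (tri≈ _ refl _) = y-1<y p
        compare (tri> _ _ q<p) = ℚₚ.<-trans (y-1<y p) (proj₁ (spaced q p q<p p≤N))

      least : ∃[ m ] m ≤ N × (∀ q → q ≤ N → upper m (C? m (suc N)) ℚ.≤ upper q (C? q (suc N)))
      least = minimum N λ q → upper q (C? q (suc N))

      value : ∃[ v ] v ℚ.< upper (proj₁ least) (C? (proj₁ least) (suc N))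
                   × (∀ p → p ℕ.< suc N → ¬ C p (suc N) → lower p ℚ.< v)
      value = squeeze (suc N) (λ p → ¬ C p (suc N)) (λ p → ¬? (C? p (suc N))) lower _ λ p p<1+N ¬c →
        lower<upper p (proj₁ least) (ℕₚ.≤-pred p<1+N) (proj₁ (proj₂ least)) ¬c (C? (proj₁ least) (suc N))

      v : ℚ
      v = proj₁ value

      v<upper : ∀ q → q ≤ N → v ℚ.< upper q (C? q (suc N))
      v<upper q q≤N = ℚₚ.<-≤-trans (proj₁ (proj₂ value)) (proj₂ (proj₂ least) q q≤N)

      place : ∀ p → Dec (p ≡ suc N) → ℚ
      place p (yes _) = v
      place p (no _)  = y p

      y′ : ℕ → ℚ
      y′ p = place p (p ℕₚ.≟ suc N)

      new : (c : Dec (suc N ≡ suc N)) → place (suc N) c ≡ v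
      new (yes _) = refl
      new (no ≢)  = contradiction refl ≢

      old : ∀ {p} → p ≤ N → (c : Dec (p ≡ suc N)) → place p c ≡ y p
      old p≤N (yes refl) = contradiction p≤N ℕₚ.1+n≰n
      old p≤N (no _)     = refl

      Spaced-≡ : ∀ {z z′ : ℕ → ℚ} {p q} → z p ≡ z′ p → z q ≡ z′ q → Spaced z p q → Spaced z′ p q
      Spaced-≡ {p = p} {q} e e′ = subst₂ (λ a b → b ℚ.< a × (C p q → 1ℚ ℚ.< a - b) × (¬ C p q → a - b ℚ.< 1ℚ)) e e′

      last : ∀ p → p ≤ N → (c : Dec (C p (suc N))) → v ℚ.< upper p c →
             v ℚ.< y p × (C p (suc N) → 1ℚ ℚ.< y p - v) × (¬ C p (suc N) → y p - v ℚ.< 1ℚ)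
      last p p≤N (yes c) v<u = ℚₚ.<-trans v<u (y-1<y p) ,
        (λ _ → shift-< v<u (solve 2 (λ a v → con 1ℚ :+ (a :- con 1ℚ) := (a :- v) :+ v) refl (y p) v)) ,
        λ ¬c → contradiction c ¬c
      last p p≤N (no ¬c) v<u = v<u , (λ c → contradiction c ¬c) , λ _ →
        shift-< (proj₂ (proj₂ value) p (s≤s p≤N) ¬c)
          (solve 2 (λ a v → (a :- v) :+ v := con 1ℚ :+ (a :- con 1ℚ)) refl (y p) v)

    extend : ∃[ y′ ] ∀ p q → p ℕ.< q → q ≤ suc N → Spaced y′ p q
    extend = y′ , λ p q p<q q≤1+N → Sum.[
        (λ q<1+N → let q≤N = ℕₚ.≤-pred q<1+N in
          Spaced-≡ {y} {y′} (sym (old (ℕₚ.≤-trans (ℕₚ.<⇒≤ p<q) q≤N) (p ℕₚ.≟ suc N))) (sym (old q≤N (q ℕₚ.≟ suc N)))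
                   (spaced p q p<q q≤N)) ,
        (λ { refl → let p≤N = ℕₚ.≤-pred p<q in
          subst₂ (λ a b → b ℚ.< a × (C p q → 1ℚ ℚ.< a - b) × (¬ C p q → a - b ℚ.< 1ℚ))
            (sym (old p≤N (p ℕₚ.≟ suc N))) (sym (new (q ℕₚ.≟ suc N)))
            (last p p≤N (C? p (suc N)) (v<upper p p≤N)) }) ]′ (ℕₚ.m≤n⇒m<n∨m≡n q≤1+N)

  realise : ∀ N → ∃[ y ] ∀ p q → p ℕ.< q → q ≤ N → Spaced y p q
  realise zero    = (λ _ → 0ℚ) , λ { _ _ () z≤n }
  realise (suc N) = let y , spaced = realise N in extend N y spaced

-- Regions

module Cells where

  open Gaps
  open Connectedness

  -- Both sides of each hyperplane in the single form of a lower bound on a difference: the upper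
  -- bound 1 on one difference becomes the lower bound -1 on the reversed one.
  data Half {n} : Fin n → Fin n → ℚ → Set where
    above0 : ∀ {i j} → i Fin.< j → Half i j 0ℚ
    below0 : ∀ {i j} → i Fin.< j → Half j i 0ℚ
    above1 : ∀ {i j} → i Fin.< j → Half i j 1ℚ
    below1 : ∀ {i j} → i Fin.< j → Half j i (ℚ.- 1ℚ)

  half0 : ∀ {i j : Fin n} → i ≢ j → Half i j 0ℚ
  half0 {i = i} {j} i≢j = compare (Finₚ.<-cmp i j)
    where
    compare : Tri (i Fin.< j) (i ≡ j) (j Fin.< i) → Half i j 0ℚ
    compare (tri< lt _ _) = above0 lt
    compare (tri≈ _ eq _) = contradiction eq i≢j
    compare (tri> _ _ gt) = below0 gt

  side : ∀ {z : ℝ^ n} → z ∈ ShiComplement n → ∀ {i j q} → Half i j q → Gap (z i) (z j) q ⊎ Gap (z j) (z i) (ℚ.- q)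
  side {z = z} z∈A (above0 {i} {j} lt) =
    Sum.[ (λ h → inj₂ (<⇒Gap {z i} {z j} {0ℚ} h)) , (λ h → inj₁ (>⇒Gap {z i} {z j} {0ℚ} h)) ]′ (proj₁ (z∈A lt))
  side {z = z} z∈A (below0 {i} {j} lt) =
    Sum.[ (λ h → inj₁ (<⇒Gap {z i} {z j} {0ℚ} h)) , (λ h → inj₂ (>⇒Gap {z i} {z j} {0ℚ} h)) ]′ (proj₁ (z∈A lt))
  side {z = z} z∈A (above1 {i} {j} lt) =
    Sum.[ (λ h → inj₂ (<⇒Gap {z i} {z j} {1ℚ} h)) , (λ h → inj₁ (>⇒Gap {z i} {z j} {1ℚ} h)) ]′ (proj₂ (z∈A lt))
  side {z = z} z∈A (below1 {i} {j} lt) =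
    Sum.[ (λ h → inj₁ (<⇒Gap {z i} {z j} {1ℚ} h)) , (λ h → inj₂ (>⇒Gap {z i} {z j} {1ℚ} h)) ]′ (proj₂ (z∈A lt))

  sides⇒complement : ∀ {z : ℝ^ n} →
    (∀ {i j} → i Fin.< j → (Gap (z i) (z j) 0ℚ ⊎ Gap (z j) (z i) 0ℚ) ×
                           (Gap (z i) (z j) 1ℚ ⊎ Gap (z j) (z i) (ℚ.- 1ℚ))) →
    z ∈ ShiComplement n
  sides⇒complement {z = z} sides {i} {j} lt =
    Sum.[ (λ g → inj₂ (Gap⇒> g)) , (λ g → inj₁ (Gap⇒< {z i} {z j} {0ℚ} g)) ]′ (proj₁ (sides lt)) ,
    Sum.[ (λ g → inj₂ (Gap⇒> g)) , (λ g → inj₁ (Gap⇒< {z i} {z j} {1ℚ} g)) ]′ (proj₂ (sides lt))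

  Gap-opposite : ∀ {x y q} → Gap x y q → ¬ Gap y x (ℚ.- q)
  Gap-opposite {q = q} = Gap-asym (ℚₚ.≤-reflexive (sym (ℚₚ.+-inverseʳ q)))

  Cell : ℝ^ n → Pred (ℝ^ n) 0ℓ
  Cell x = HalfSpaces λ i j q → Half i j q × Gap (x i) (x j) q

  Cell-trans : ∀ {x y z : ℝ^ n} → Cell x y → Cell y z → Cell x z
  Cell-trans xy yz (h , g) = yz (h , xy (h , g))

  Cell⊆complement : ∀ {x : ℝ^ n} → x ∈ ShiComplement n → Cell x ⊆ ShiComplement n
  Cell⊆complement {x = x} x∈A {z} z∈ = sides⇒complement λ lt →
    Sum.[ (λ g → inj₁ (z∈ (above0 lt , g))) , (λ g → inj₂ (z∈ (below0 lt , g))) ]′ (side {z = x} x∈A (above0 lt)) ,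
    Sum.[ (λ g → inj₁ (z∈ (above1 lt , g))) , (λ g → inj₂ (z∈ (below1 lt , g))) ]′ (side {z = x} x∈A (above1 lt))

  Cell⊆Component : ∀ {x : ℝ^ n} → x ∈ ShiComplement n → Cell x ⊆ Component (ShiComplement n) x
  Cell⊆Component {x = x} x∈A z∈ =
    Cell x , (λ {z} → Cell⊆complement {x = x} x∈A {z}) , HalfSpaces-connected _ , proj₂ , z∈

  Component⊆Cell : ∀ {x : ℝ^ n} → Component (ShiComplement n) x ⊆ Cell x
  Component⊆Cell {n = n} {x = x} {z} (S , S⊆A , conn , x∈S , z∈S) {i} {j} {q} (h , g) =
    Sum.[ id , separated ]′ (side {z = z} (S⊆A z∈S) h)
    where
    separated : Gap (z j) (z i) (ℚ.- q) → Gap (z i) (z j) q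
    separated g′ =
      let _ , _ , u , v = conn (λ y → Gap (y i) (y j) q) (λ y → Gap (y j) (y i) (ℚ.- q))
                            (Gap-open i j q) (Gap-open j i (ℚ.- q))
                            (λ {y} y∈S → side {z = y} (S⊆A y∈S) h) (x , x∈S , g) (z , z∈S , g′)
      in contradiction v (Gap-opposite u)

-- Words are compared by their positions and initial arcs up to equivalence, so independence of the
-- diagram from these choices needs a proof.
module Transport {n} {w w′ : Permutation′ n} {I : Rel (Fin n) ℓ} {I′ : Rel (Fin n) ℓ′}
                 (pos≡ : ∀ i → Positions.pos w i ≡ Positions.pos w′ i)
                 (I⇒I′ : ∀ {i j} → I i j → I′ i j) (I′⇒I : ∀ {i j} → I′ i j → I i j) where

  private
    module D = ShiDiagram w I
    module D′ = ShiDiagram w′ I′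

    Arc⇒Arc′ : ∀ {i j} → D.Arc i j → D′.Arc i j
    Arc⇒Arc′ (ij , none) = I⇒I′ ij , λ (j , k , jk , neq , le , le′) →
      none (j , k , I′⇒I jk , neq , subst₂ Fin._≤_ (sym (pos≡ _)) (sym (pos≡ _)) le ,
                                    subst₂ Fin._≤_ (sym (pos≡ _)) (sym (pos≡ _)) le′)

    Arc′⇒Arc : ∀ {i j} → D′.Arc i j → D.Arc i j
    Arc′⇒Arc (ij , none) = I′⇒I ij , λ (j , k , jk , neq , le , le′) →
      none (j , k , I⇒I′ jk , neq , subst₂ Fin._≤_ (pos≡ _) (pos≡ _) le , subst₂ Fin._≤_ (pos≡ _) (pos≡ _) le′)

  starts : ∀ {f} → D.ChainStarts f → D′.ChainStarts f
  starts h i = let m , (s , left) , e = h i in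
    m , (EqC.map Arc⇒Arc′ s , λ k s′ → subst₂ Fin._≤_ (pos≡ m) (pos≡ k) (left k (EqC.map Arc′⇒Arc s′))) ,
    trans e (pos≡ m)

module Ranking {n} {P : Rel (Fin n) ℓ} (P? : Decidable P)
               (P-irrefl : ∀ {i} → ¬ P i i) (P-trans : ∀ {i j k} → P i j → P j k → P i k)
               (P-total : ∀ {i j} → i ≢ j → P i j ⊎ P j i) where

  private
    above : Fin n → List (Fin n)
    above i = filter (λ j → P? j i) (allFin n)

    ∈above⇒P : ∀ i k → P (lookup (above i) k) i
    ∈above⇒P i k = proj₂ (∈-filter⁻ (λ j → P? j i) {xs = allFin n} (∈-lookup k))

    -- Adjoining i to the elements above it serves twice: as an injection into `Fin n` it bounds the
    -- rank, and for `P i j` it lands among the elements above j, which makes the rank strictly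
    -- monotone.
    adjoin : ∀ i → Fin (suc (length (above i))) → Fin n
    adjoin i Fin.zero    = i
    adjoin i (Fin.suc k) = lookup (above i) k

    adjoin-injective : ∀ i → Injective _≡_ _≡_ (adjoin i)
    adjoin-injective i {Fin.zero}  {Fin.zero}  eq = refl
    adjoin-injective i {Fin.zero}  {Fin.suc l} eq =
      contradiction (subst (λ z → P z i) (sym eq) (∈above⇒P i l)) P-irrefl
    adjoin-injective i {Fin.suc k} {Fin.zero}  eq =
      contradiction (subst (λ z → P z i) eq (∈above⇒P i k)) P-irrefl
    adjoin-injective i {Fin.suc k} {Fin.suc l} eq =
      cong Fin.suc (Unique⇒lookup-injective (filter⁺ (λ j → P? j i) (allFin⁺ n)) eq)

    rank : Fin n → Fin n
    rank i = fromℕ< (Finₚ.injective⇒≤ (adjoin-injective i))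

    toℕ-rank : ∀ i → toℕ (rank i) ≡ length (above i)
    toℕ-rank i = Finₚ.toℕ-fromℕ< _

    rank-mono : ∀ {i j} → P i j → rank i Fin.< rank j
    rank-mono {i} {j} pij = subst₂ ℕ._<_ (sym (toℕ-rank i)) (sym (toℕ-rank j))
      (injection⇒≤length (λ k → P? k j) (adjoin i) (adjoin-injective i)
        λ { Fin.zero → pij ; (Fin.suc k) → P-trans (∈above⇒P i k) pij })

    rank-injective : Injective _≡_ _≡_ rank
    rank-injective {i} {j} eq with i Finₚ.≟ j
    ... | yes i≡j = i≡j
    ... | no i≢j with P-total i≢j
    ...   | inj₁ p = contradiction (rank-mono p) (ℕₚ.<-irrefl (cong toℕ eq))
    ...   | inj₂ p = contradiction (rank-mono p) (ℕₚ.<-irrefl (cong toℕ (sym eq)))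

  sorting : ∃[ w ] ∀ {i j} → P i j → Positions.pos w i Fin.< Positions.pos w j
  sorting = let w , pos≡ = injective⇒permutation rank rank-injective
            in w , λ p → subst₂ Fin._<_ (sym (pos≡ _)) (sym (pos≡ _)) (rank-mono p)

open Positions

-- Each step to the right in w is at least one step to the right in w′. Used in both directions,
-- this shows that a region has only one word.
pos-≤ : (w w′ : Permutation′ n) → (∀ {i j} → pos w i Fin.< pos w j → pos w′ i Fin.< pos w′ j) →
        ∀ i → pos w i Fin.≤ pos w′ i
pos-≤ {n} w w′ mono i = go (pos w i) i refl
  where
  go : ∀ p i → pos w i ≡ p → p Fin.≤ pos w′ i
  go p i = bound (toℕ p) (toℕ<n p) i ∘ cong toℕ
    where
    bound : ∀ k → k ℕ.< n → ∀ i → toℕ (pos w i) ≡ k → k ≤ toℕ (pos w′ i)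
    bound zero    _   i _  = z≤n
    bound (suc k) k<n i eq =
      let j = word w (fromℕ< (ℕₚ.<⇒≤ k<n))
          at : toℕ (pos w j) ≡ k
          at = trans (cong toℕ (pos-word w _)) (Finₚ.toℕ-fromℕ< _)
      in ℕₚ.≤-trans (s≤s (bound k (ℕₚ.<⇒≤ k<n) j at))
           (mono (subst₂ ℕ._<_ (sym at) (sym eq) ℕₚ.≤-refl))

-- The map on regions and its inverse

module Regions where

  open Gaps
  open Cells

  module RegionFacts {n} (R : Region n) where

    centre : ℝ^ n
    centre = proj₁ (isComponent R)

    centre∈A : centre ∈ ShiComplement n
    centre∈A = proj₁ (proj₂ (isComponent R))

    points⊆Cell : points R ⊆ Cell centre
    points⊆Cell z∈ = Component⊆Cell (proj₁ (proj₂ (proj₂ (isComponent R))) z∈)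

    Cell⊆points : Cell centre ⊆ points R
    Cell⊆points z∈ = proj₂ (proj₂ (proj₂ (isComponent R))) (Cell⊆Component {x = centre} centre∈A z∈)

    centre∈points : centre ∈ points R
    centre∈points = Cell⊆points {centre} proj₂

    _≻_ : Rel (Fin n) 0ℓ
    i ≻ j = Gap (centre i) (centre j) 0ℚ

    ≻-irrefl : ∀ {i} → ¬ i ≻ i
    ≻-irrefl g = ℚₚ.<-irrefl refl (Gap-irrefl g)

    ≻-trans : ∀ {i j k} → i ≻ j → j ≻ k → i ≻ k
    ≻-trans = Gap-trans

    ≻⇒≢ : ∀ {i j} → i ≻ j → i ≢ j
    ≻⇒≢ g refl = ≻-irrefl g

    ≻-total : ∀ {i j} → i ≢ j → i ≻ j ⊎ j ≻ i
    ≻-total i≢j = side {z = centre} centre∈A (half0 i≢j)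

    _≻?_ : Decidable _≻_
    i ≻? j = decide (i Finₚ.≟ j)
      where
      decide : Dec (i ≡ j) → Dec (i ≻ j)
      decide (yes refl) = no ≻-irrefl
      decide (no i≢j) = Sum.[ yes , (λ g → no λ g′ → ≻-irrefl (≻-trans g′ g)) ]′ (≻-total i≢j)

    ≻⇒points : ∀ {i j} → i ≻ j → ∀ {z} → z ∈ points R → z i >ᵣ z j
    ≻⇒points {i} {j} g {z} z∈ = Gap⇒>ᵣ {z i} {z j} (points⊆Cell z∈ (half0 (≻⇒≢ g) , g))

    arc⇒InitialArc : ∀ {i j} → i Fin.< j → Gap (centre i) (centre j) 1ℚ → InitialArc R i j
    arc⇒InitialArc i<j g = i<j , λ z z∈ → Gap⇒> (points⊆Cell z∈ (above1 i<j , g))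

    InitialArc⇒arc : ∀ {i j} → InitialArc R i j → Gap (centre i) (centre j) 1ℚ
    InitialArc⇒arc {i} {j} (_ , h) = >⇒Gap {centre i} {centre j} {1ℚ} (h centre centre∈points)

    module _ (w : Permutation′ n) (order : OrderedBy R w) where

      pos<⇒≻ : ∀ {i j} → pos w i Fin.< pos w j → i ≻ j
      pos<⇒≻ {i} {j} lt = subst₂ _≻_ (word-pos w i) (word-pos w j)
        (>ᵣ⇒Gap {centre (word w (pos w i))} {centre (word w (pos w j))} (order centre centre∈points lt))

      ≻⇒pos< : ∀ {i j} → i ≻ j → pos w i Fin.< pos w j
      ≻⇒pos< {i} {j} g = compare (Finₚ.<-cmp (pos w i) (pos w j))
        where
        compare : Tri (pos w i Fin.< pos w j) (pos w i ≡ pos w j) (pos w j Fin.< pos w i) → pos w i Fin.< pos w j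
        compare (tri< lt _ _) = lt
        compare (tri≈ _ eq _) = contradiction (pos-injective w eq) (≻⇒≢ g)
        compare (tri> _ _ gt) = contradiction (≻-trans g (pos<⇒≻ gt)) ≻-irrefl

      pos≤⇒Gap : ∀ {i j k q} → pos w i Fin.≤ pos w j → Gap (centre j) (centre k) q → Gap (centre i) (centre k) q
      pos≤⇒Gap {i} {j} {k} {q} le g = Sum.[
        (λ lt → subst (Gap (centre i) (centre k)) (ℚₚ.+-identityˡ q) (Gap-trans (pos<⇒≻ lt) g)) ,
        (λ eq → subst (λ z → Gap (centre z) (centre k) q) (sym (pos-injective w (toℕ-injective eq))) g) ]′
        (ℕₚ.m≤n⇒m<n∨m≡n le)

      Gap-pos≤ : ∀ {i k l q} → Gap (centre i) (centre k) q → pos w k Fin.≤ pos w l → Gap (centre i) (centre l) q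
      Gap-pos≤ {i} {k} {l} {q} g le = Sum.[
        (λ lt → subst (Gap (centre i) (centre l)) (ℚₚ.+-identityʳ q) (Gap-trans g (pos<⇒≻ lt))) ,
        (λ eq → subst (λ z → Gap (centre i) (centre z) q) (pos-injective w (toℕ-injective eq)) g) ]′
        (ℕₚ.m≤n⇒m<n∨m≡n le)

      isShi : ShiDiagram.IsShi w (InitialArc R)
      isShi .ShiDiagram.IsShi.I? i j = decide (i Finₚ.<? j)
        where
        decide : Dec (i Fin.< j) → Dec (InitialArc R i j)
        decide (no i≮j) = no (i≮j ∘ proj₁)
        decide (yes i<j) = Sum.[ (λ g → yes (arc⇒InitialArc i<j g))
                               , (λ g → no λ arc → Gap-opposite (InitialArc⇒arc arc) g) ]′ (side {z = centre} centre∈A (above1 i<j))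
      isShi .ShiDiagram.IsShi.I⇒< = proj₁
      isShi .ShiDiagram.IsShi.I⇒pos< arc = ≻⇒pos< (Gap-weaken (ℚₚ.<⇒≤ (ℚ-Arithmetic.δ-pos 0)) (InitialArc⇒arc arc))
      isShi .ShiDiagram.IsShi.I-up i<l (j , k , jk , ij , kl) =
        arc⇒InitialArc i<l (pos≤⇒Gap ij (Gap-pos≤ (InitialArc⇒arc jk) kl))

    private
      sorted = Ranking.sorting _≻?_ ≻-irrefl ≻-trans ≻-total

    w : Permutation′ n
    w = proj₁ sorted

    sorted⇒≻ : ∀ {i j} → pos w i Fin.< pos w j → i ≻ j
    sorted⇒≻ {i} {j} lt = Sum.[ id , (λ g → contradiction lt (ℕₚ.<⇒≯ (proj₂ sorted g))) ]′
      (≻-total λ { refl → ℕₚ.<-irrefl refl lt })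

    ordered : OrderedBy R w
    ordered z z∈ {p} {q} p<q = ≻⇒points
      (sorted⇒≻ (subst₂ Fin._<_ (sym (pos-word w p)) (sym (pos-word w q)) p<q)) {z} z∈

    open ShiDiagram.IsShi (isShi w ordered) public using (root; root-starts)

    σ : Fin n → Fin n
    σ i = pos w (root i)

    σ-parking : IsParking σ
    σ-parking = ShiDiagram.IsShi.parking (isShi w ordered) root-starts

    sends-σ : Sends R σ
    sends-σ = w , ordered , root-starts

    -- Any word permitted by `Sends` orders the coordinates of the centre, as the chosen word does,
    -- so the two have equal positions and the same chain starts.
    sends⇒≗σ : ∀ {f} → Sends R f → f ≗ σ
    sends⇒≗σ (w′ , order′ , starts) = ShiDiagram.IsShi.starts-unique (isShi w ordered)
      (Transport.starts {w = w′} {w} (λ i → Finₚ.≤-antisym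
          (pos-≤ w′ w (≻⇒pos< w ordered ∘ pos<⇒≻ w′ order′) i)
          (pos-≤ w w′ (≻⇒pos< w′ order′ ∘ pos<⇒≻ w ordered) i)) id id starts)

    ≗σ⇒sends : ∀ {f} → f ≗ σ → Sends R f
    ≗σ⇒sends f≗σ = w , ordered , λ i → root i , proj₁ (proj₂ (root-starts i)) , f≗σ i

  open RegionFacts

  sends-cong : ∀ {R R′ : Region n} {f} → points R ≐ points R′ → Sends R f → Sends R′ f
  sends-cong {R = R} {R′} (R⊆R′ , R′⊆R) (w , order , starts) =
    w , (λ z z∈ → order z (R′⊆R z∈)) ,
    Transport.starts {w = w} {w} {InitialArc R} {InitialArc R′} (λ _ → refl)
      (λ (lt , h) → lt , λ z z∈ → h z (R′⊆R z∈)) (λ (lt , h) → lt , λ z z∈ → h z (R⊆R′ z∈)) starts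

  σ-cong : ∀ {R R′ : Region n} → points R ≐ points R′ → σ R ≗ σ R′
  σ-cong {R = R} {R′} R≐R′ = sends⇒≗σ R′ (sends-cong {R = R} {R′} R≐R′ (sends-σ R))

  module _ {R R′ : Region n} {w w′ : Permutation′ n} (order : OrderedBy R w) (order′ : OrderedBy R′ w′)
           (pos≡ : ∀ i → pos w i ≡ pos w′ i)
           (arc⇒ : ∀ {i j} → InitialArc R i j → InitialArc R′ i j)
           (arc⇐ : ∀ {i j} → InitialArc R′ i j → InitialArc R i j) where

    same-cell : Cell (centre R) (centre R′)
    same-cell (above0 lt , g) = pos<⇒≻ R′ w′ order′ (subst₂ Fin._<_ (pos≡ _) (pos≡ _) (≻⇒pos< R w order g))
    same-cell (below0 lt , g) = pos<⇒≻ R′ w′ order′ (subst₂ Fin._<_ (pos≡ _) (pos≡ _) (≻⇒pos< R w order g))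
    same-cell (above1 lt , g) = InitialArc⇒arc R′ (arc⇒ (arc⇒InitialArc R lt g))
    -- On the far side of this hyperplane the second centre would yield an initial arc, which the
    -- first region would share.
    same-cell (below1 lt , g) = Sum.[ id ,
      (λ g′ → contradiction g (Gap-opposite (InitialArc⇒arc R (arc⇐ (arc⇒InitialArc R′ lt g′))))) ]′
      (side {z = centre R′} (centre∈A R′) (below1 lt))

    points⊇ : points R′ ⊆ points R
    points⊇ {z} z∈ = Cell⊆points R {z} (Cell-trans {x = centre R} {centre R′} {z} same-cell (points⊆Cell R′ z∈))

  σ-injective : ∀ {R R′ : Region n} → σ R ≗ σ R′ → points R ≐ points R′
  σ-injective {R = R} {R′} eq =
    (λ {z} → points⊇ {R = R′} {R} {w₂} {w₁} order′ order (sym ∘ pos≡) arc⇐ arc⇒ {z}) ,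
    (λ {z} → points⊇ {R = R} {R′} {w₁} {w₂} order order′ pos≡ arc⇒ arc⇐ {z})
    where
    w₁ w₂ : Permutation′ _
    w₁ = w R
    w₂ = w R′
    order = ordered R
    order′ = ordered R′
    starts = root-starts R
    starts′ = proj₂ (proj₂ (≗σ⇒sends R′ eq))
    shi = isShi R w₁ order
    shi′ = isShi R′ w₂ order′
    pos≡ : ∀ i → pos w₁ i ≡ pos w₂ i
    pos≡ = LayoutUniqueness.pos-unique {w = w₁} {w₂}
      (ShiDiagram.IsShi.layout shi starts) (ShiDiagram.IsShi.layout shi′ starts′)
    arc⇒ : ∀ {i j} → InitialArc R i j → InitialArc R′ i j
    arc⇒ arc = let lt , j , k , jk , le , le′ = proj₁ (ShiDiagram.IsShi.I⇔Contains-Next shi starts) arc in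
      proj₂ (ShiDiagram.IsShi.I⇔Contains-Next shi′ starts′)
        (lt , j , k , jk , subst₂ Fin._≤_ (pos≡ _) (pos≡ _) le , subst₂ Fin._≤_ (pos≡ _) (pos≡ _) le′)
    arc⇐ : ∀ {i j} → InitialArc R′ i j → InitialArc R i j
    arc⇐ arc = let lt , j , k , jk , le , le′ = proj₁ (ShiDiagram.IsShi.I⇔Contains-Next shi′ starts′) arc in
      proj₂ (ShiDiagram.IsShi.I⇔Contains-Next shi starts)
        (lt , j , k , jk , subst₂ Fin._≤_ (sym (pos≡ _)) (sym (pos≡ _)) le ,
                            subst₂ Fin._≤_ (sym (pos≡ _)) (sym (pos≡ _)) le′)

  module Realisation {f : Fin n → Fin n} {w : Permutation′ n} (L : Layout f w) where

    open Layout L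
    open ℚ-Arithmetic using (shift-<; δ-pos)
    open +-*-Solver using (solve; _:=_; _:+_; _:-_; :-_; con)

    -- Labels are left out so that the relation is closed under enlarging intervals, as `Semiorder`
    -- demands. Where labels decrease from left to right, the difference is negative in the order of
    -- the labels, and the prescribed distance crosses no hyperplane.
    Spans : Rel ℕ 0ℓ
    Spans p q = ∃[ j ] ∃[ k ] Next f j k × p ≤ toℕ (pos w j) × toℕ (pos w k) ≤ q

    Spans? : Decidable Spans
    Spans? p q = any? λ j → any? λ k → Next? f j k ×-dec (p ℕₚ.≤? toℕ (pos w j)) ×-dec (toℕ (pos w k) ℕₚ.≤? q)

    Spans-up : ∀ {p p′ q q′} → p′ ≤ p → q ≤ q′ → Spans p q → Spans p′ q′
    Spans-up p′≤p q≤q′ (j , k , jk , le , le′) = j , k , jk , ℕₚ.≤-trans p′≤p le , ℕₚ.≤-trans le′ q≤q′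

    private
      realised = Semiorder.realise Spans Spans? Spans-up n

    height : Fin n → ℚ
    height i = proj₁ realised (toℕ (pos w i))

    point : ℝ^ n
    point i = fromℚ (height i)

    spaced : ∀ {i j} → pos w i Fin.< pos w j →
             Semiorder.Spaced Spans Spans? Spans-up (proj₁ realised) (toℕ (pos w i)) (toℕ (pos w j))
    spaced {i} {j} lt = proj₂ realised _ _ lt (ℕₚ.<⇒≤ (toℕ<n (pos w j)))

    above : ∀ {i j} → pos w i Fin.< pos w j → Gap (point i) (point j) 0ℚ
    above {i} {j} lt = Gap-fromℚ (shift-< (proj₁ (spaced lt))
      (solve 2 (λ a b → con 0ℚ :+ a := (a :- b) :+ b) refl (height i) (height j)))

    far : ∀ {i j} → pos w i Fin.< pos w j → Spans (toℕ (pos w i)) (toℕ (pos w j)) → Gap (point i) (point j) 1ℚ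
    far lt s = Gap-fromℚ (proj₁ (proj₂ (spaced lt)) s)

    close : ∀ {i j} → pos w i Fin.< pos w j → ¬ Spans (toℕ (pos w i)) (toℕ (pos w j)) →
            Gap (point j) (point i) (ℚ.- 1ℚ)
    close {i} {j} lt ¬s = Gap-fromℚ (shift-< (proj₂ (proj₂ (spaced lt)) ¬s)
      (solve 2 (λ a b → (:- con 1ℚ) :+ con 1ℚ := (b :- a) :+ (a :- b)) refl (height i) (height j)))

    -1≤0 : ℚ.- 1ℚ ℚ.≤ 0ℚ
    -1≤0 = ℚ.*≤* ℤ.-≤+

    point∈A : point ∈ ShiComplement n
    point∈A = sides⇒complement {z = point} λ {i} {j} lt → compare lt (Finₚ.<-cmp (pos w i) (pos w j))
      where
      compare : ∀ {i j} → i Fin.< j → Tri (pos w i Fin.< pos w j) (pos w i ≡ pos w j) (pos w j Fin.< pos w i) →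
                (Gap (point i) (point j) 0ℚ ⊎ Gap (point j) (point i) 0ℚ) ×
                (Gap (point i) (point j) 1ℚ ⊎ Gap (point j) (point i) (ℚ.- 1ℚ))
      compare {i} {j} _ (tri< lt _ _) = inj₁ (above lt) , decide (Spans? (toℕ (pos w i)) (toℕ (pos w j)))
        where
        decide : Dec (Spans (toℕ (pos w i)) (toℕ (pos w j))) →
                 Gap (point i) (point j) 1ℚ ⊎ Gap (point j) (point i) (ℚ.- 1ℚ)
        decide (yes s) = inj₁ (far lt s)
        decide (no ¬s) = inj₂ (close lt ¬s)
      compare i<j (tri≈ _ eq _) = contradiction (cong toℕ (pos-injective w eq)) (ℕₚ.<⇒≢ i<j)
      -- Here the difference is negative, which settles both hyperplanes at once.
      compare _ (tri> _ _ gt) = inj₂ (above gt) , inj₂ (Gap-weaken -1≤0 (above gt))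

    region : Region n
    region .points = Component (ShiComplement n) point
    region .isComponent = point , point∈A , id , id

    region-ordered : OrderedBy region w
    region-ordered z z∈ {p} {q} p<q = ≻⇒points region
      (above (subst₂ Fin._<_ (sym (pos-word w p)) (sym (pos-word w q)) p<q)) {z} z∈

    arc⇒Spans : ∀ {i l} → InitialArc region i l → Spans (toℕ (pos w i)) (toℕ (pos w l))
    arc⇒Spans {i} {l} arc = decide (Spans? (toℕ (pos w i)) (toℕ (pos w l)))
      where
      i<l : pos w i Fin.< pos w l
      i<l = ShiDiagram.IsShi.I⇒pos< (isShi region w region-ordered) arc
      decide : Dec (Spans (toℕ (pos w i)) (toℕ (pos w l))) → Spans (toℕ (pos w i)) (toℕ (pos w l))
      decide (yes s) = s
      decide (no ¬s) = contradiction (close i<l ¬s) (Gap-opposite (InitialArc⇒arc region arc))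

    Next⇒arc : ∀ {i l} → Next f i l → InitialArc region i l
    Next⇒arc {i} {l} nx = arc⇒InitialArc region (proj₁ (proj₂ nx))
      (far (Next⇒pos< nx) (i , l , nx , ℕₚ.≤-refl , ℕₚ.≤-refl))

    sends : Sends region f
    sends = w , region-ordered , ShiDiagram.layout⇒starts w (InitialArc region) L arc⇒Spans Next⇒arc

theorem2p2 : (n : ℕ) → 1 ≤ n →
    Σ[ σ ∈ Bijection (regions n) (parkingFunctions n) ]
    (∀ (R : Region n) (f : Fin n → Fin n) → Sends R f ⇔ f ≗ proj₁ (Bijection.to σ R))
theorem2p2 n _ = bijection , λ R f → mk⇔ (sends⇒≗σ R) (≗σ⇒sends R)
  where
  open Regions
  open RegionFacts
  bijection : Bijection (regions n) (parkingFunctions n)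
  bijection = record
    { to = λ R → σ R , σ-parking R
    ; cong = λ {R} {R′} → σ-cong {R = R} {R′}
    ; bijective = (λ {R} {R′} → σ-injective {R = R} {R′}) , λ (f , parking) →
        let w , L = Construction.layout-exists f parking
            open Realisation L
        in region , λ {R} R≐ i → trans (σ-cong {R = R} {region} R≐ i) (sym (sends⇒≗σ region sends i)) }
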